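{- Let $\lambda,\lambda'\ge 2$ be integers, let $\underline{u}=(u_1,\dots,u_r)$, $\underline{v}=(v_1,\dots,v_r)$, $\underline{u}'=(u'_1,\dots,u'_{r'})$, $\underline{v}'=(v'_1,\dots,v'_{r'})$ be vectors of integers $\ge 2$, and put $N=u_1v_1\cdots u_rv_r$, $N'=u'_1v'_1\cdots u'_{r'}v'_{r'}$. Assume that \[ R_{\underline{\lambda}^{(\underline{u})}_{\underline{u},\underline{v}}S^{(\lambda,N)},\,\underline{\lambda}^{(\underline{v})}_{\underline{u},\underline{v}}} = R_{(\underline{\lambda'})^{(\underline{u}')}_{\underline{u}',\underline{v}'}S^{(\lambda',N')},\,(\underline{\lambda'})^{(\underline{v}')}_{\underline{u}',\underline{v}'}} = 1 \qquad (\ast) \] (i.e. both sides represent every $n\in\mathbb{N}$ exactly once) is a non-trivial solution in which $\underline{\lambda}^{(\underline{v})}_{\underline{u},\underline{v}}\neq(1)$ and $(\underline{\lambda'})^{(\underline{v}')}_{\underline{u}',\underline{v}'}\neq(1)$. Then the following statements are equivalent: (i) $\log\lambda$ and $\log\lambda'$ are linearly independent over $\mathbb{Q}$; (ii) $(\ast)$ is a primitive solution; (iii) $(\ast)$ does not arise from the first construction.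
   Context: $\mathbb{N}_m$ denotes the set of multisets $M$ of nonnegative integers in which $0$ has multiplicity $1$ and every positive integer has finite multiplicity. $\mathbb{Z}^+_m$ denotes the set of vectors $\underline{\alpha}=(\alpha_1,\dots,\alpha_s)$ with $1\le\alpha_1\le\dots\le\alpha_s$ positive integers ($s$ not fixed). For a multiset $A=\{a_1,a_2,\dots\}$ and $\underline{\alpha}\in\mathbb{Z}^+_m$, $R_{A,\underline{\alpha}}(n)=|\{(j_1,\dots,j_s): j_i\in\mathbb{Z}^+,\ \sum_{i=1}^s\alpha_i a_{j_i}=n\}|$, and $\underline{\alpha}A$ is the multiset $\alpha_1A+\dots+\alpha_sA$ (so $R_{A,\underline{\alpha}}=R_{B,\underline{\beta}}$ means $\underline{\alpha}A=\underline{\beta}B$). For vectors $\underline{\alpha},\underline{\beta}$, $\underline{\alpha}\,\underline{\beta}$ denotes the ordered Kronecker product $(\alpha_i\beta_j)_{i,j}$ (sorted). A solution is trivial if $(A,\underline{\alpha})=(B,\underline{\beta})$. For an integer $\lambda\ge2$ and $N\in\mathbb{Z}^+$, $S^{(\lambda,N)}=\{\sum_{i\ge0}\delta_i\lambda^{iN}: \delta_i\in\{0,1,\dots,\lambda-1\}\}$ (finite sums). With $P_i=u_1v_1\cdots u_{i-1}v_{i-1}$ (so $P_1=1$), $\underline{\lambda}^{(\underline{u})}_{\underline{u},\underline{v}}=\prod_{i=1}^{r}(1,\lambda^{P_i},\lambda^{2P_i},\dots,\lambda^{(u_i-1)P_i})$ and $\underline{\lambda}^{(\underline{v})}_{\underline{u},\underline{v}}=\prod_{i=1}^{r}(1,\lambda^{P_iu_i},\lambda^{2P_iu_i},\dots,\lambda^{(v_i-1)P_iu_i})$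 (Kronecker products), so that $\underline{\lambda}^{(\underline{u})}_{\underline{u},\underline{v}}\underline{\lambda}^{(\underline{v})}_{\underline{u},\underline{v}}=(1,\lambda,\dots,\lambda^{N-1})$; analogously for $\lambda',\underline{u}',\underline{v}'$, $N'$. A solution of $\underline{\alpha}A=\underline{\beta}B$ (with $A,B\in\mathbb{N}_m$, $\underline{\alpha},\underline{\beta}\in\mathbb{Z}^+_m$) is primitive if whenever $\underline{\alpha}_1,\underline{\alpha}_2,\underline{\beta}_1,\underline{\beta}_2,\underline{\gamma},\underline{\delta}\in\mathbb{Z}^+_m$ and $C,D\in\mathbb{N}_m$ with $|C|,|D|\ge2$ satisfy $A=\underline{\alpha}_1C$, $\underline{\alpha}=\underline{\gamma}\,\underline{\alpha}_2$, $B=\underline{\beta}_1D$, $\underline{\beta}=\underline{\delta}\,\underline{\beta}_2$ and $\underline{\alpha}_1\underline{\alpha}_2=\underline{\beta}_1\underline{\beta}_2$, then $\underline{\alpha}_1=\underline{\beta}_1=\underline{\alpha}_2=\underline{\beta}_2=(1)$. A solution arises from the first construction if there are $\underline{\alpha}_1,\underline{\alpha}_2,\underline{\beta}_1,\underline{\beta}_2\in\mathbb{Z}^+_m$ with $\underline{\alpha}_1\underline{\alpha}_2=\underline{\beta}_1\underline{\beta}_2$, $(\underline{\alpha}_1,\underline{\alpha}_2)\ne(\underline{\beta}_1,\underline{\beta}_2)$, and $C\in\mathbb{N}_m$ such that $A=\underline{\alpha}_1C$, $\underline{\alpha}=\underline{\alpha}_2$, $B=\underline{\beta}_1C$, $\underline{\beta}=\underline{\beta}_2$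 (so that $R_{\underline{\alpha}_1C,\underline{\alpha}_2}=R_{\underline{\beta}_1C,\underline{\beta}_2}$). -}

module Defs where

open import Data.Nat using (ℕ; zero; suc; _+_; _*_; _∸_; _^_; _≤_; _<_; _≤ᵇ_; _%_; _/_; _≡ᵇ_)
open import Data.Nat.Properties using (≤-decTotalOrder)
open import Data.Bool using (Bool; true; false; if_then_else_; _∧_)
open import Data.List using (List; []; _∷_; map; concatMap; upTo; length)
open import Data.List.Relation.Unary.All using (All)
open import Data.List.Relation.Unary.Sorted.TotalOrder using (Sorted)
open import Data.Vec using (Vec; []; _∷_)
open import Data.Product using (Σ; _×_; ∃; ∃-syntax; _,_)
open import Relation.Binary.PropositionalEquality using (_≡_)
open import Relation.Nullary using (¬_)
import Data.List.Sort.MergeSort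

open Data.List.Sort.MergeSort ≤-decTotalOrder using (sort)
open import Data.Nat.Properties using (≤-totalOrder)

-- Multisets of nonnegative integers, given by their multiplicity
-- function.  ℕₘ : multiplicity of 0 is 1 (finiteness is automatic).

Multiset : Set
Multiset = ℕ → ℕ

IsNm : Multiset → Set
IsNm A = A 0 ≡ 1

-- |C| ≥ 2 (counted with multiplicity): since 0 has multiplicity 1,
-- this means C contains some positive element.
CardAtLeast2 : Multiset → Set
CardAtLeast2 C = ∃[ n ] (0 < n × 0 < C n)

_≋_ : Multiset → Multiset → Set
A ≋ B = ∀ n → A n ≡ B n

IsZm : List ℕ → Set
IsZm α = Sorted ≤-totalOrder α × All (1 ≤_) α × 1 ≤ length α

kron : List ℕ → List ℕ → List ℕ
kron α β = sort (concatMap (λ a → map (a *_) β) α)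

-- R_{A,α}(n): number of (j₁,…,j_s) with Σ αᵢ a_{jᵢ} = n.
-- Counted via multiplicities: Σ over x₁,…,x_s with Σ αᵢ xᵢ = n of
-- Π A(xᵢ).  Since αᵢ ≥ 1 each xᵢ ≤ n.

sumTo : ℕ → (ℕ → ℕ) → ℕ
sumTo zero    f = f 0
sumTo (suc k) f = sumTo k f + f (suc k)

R : Multiset → List ℕ → ℕ → ℕ
R A []      n = if n ≡ᵇ 0 then 1 else 0
R A (a ∷ α) n = sumTo n (λ x → if a * x ≤ᵇ n then A x * R A α (n ∸ a * x) else 0)

-- the multiset α A = α₁A + ⋯ + α_sA
dil : List ℕ → Multiset → Multiset
dil α A = R A α

-- S^{(λ,N)} = { Σ δᵢ λ^{iN} : 0 ≤ δᵢ < λ } (a set, multiplicities 0/1).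
-- n ∈ S iff every base-λ digit of n at a position not divisible by N
-- is 0.  'digitsOK fuel λ N pos n' checks the digits of n, where pos is
-- the position of the lowest digit of n.

digitsOK : ℕ → (λ' N pos n : ℕ) → Bool
digitsOK zero       l N pos n = true
digitsOK (suc fuel) l N pos n with l
... | zero  = true
... | suc k =
  ((pos % suc (N ∸ 1) ≡ᵇ 0) Data.Bool.∨ (n % suc k ≡ᵇ 0))
  ∧ digitsOK fuel (suc k) N (suc pos) (n / suc k)

S : (λ' N : ℕ) → Multiset
S l N n = if digitsOK (suc n) l N 0 n then 1 else 0

geom : (λ' e k : ℕ) → List ℕ
geom l e k = map (λ i → l ^ (i * e)) (upTo k)

lamU' : ℕ → (l : ℕ) → ∀ {r} → Vec ℕ r → Vec ℕ r → List ℕ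
lamU' P l []       []       = 1 ∷ []
lamU' P l (u ∷ us) (v ∷ vs) = kron (geom l P u) (lamU' (P * u * v) l us vs)

lamV' : ℕ → (l : ℕ) → ∀ {r} → Vec ℕ r → Vec ℕ r → List ℕ
lamV' P l []       []       = 1 ∷ []
lamV' P l (u ∷ us) (v ∷ vs) = kron (geom l (P * u) v) (lamV' (P * u * v) l us vs)

lamU lamV : (l : ℕ) → ∀ {r} → Vec ℕ r → Vec ℕ r → List ℕ
lamU = lamU' 1
lamV = lamV' 1

prodUV : ∀ {r} → Vec ℕ r → Vec ℕ r → ℕ
prodUV []       []       = 1
prodUV (u ∷ us) (v ∷ vs) = u * v * prodUV us vs

NonTrivial : Multiset → List ℕ → Multiset → List ℕ → Set
NonTrivial A α B β = ¬ (A ≋ B × α ≡ β)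

Primitive : Multiset → List ℕ → Multiset → List ℕ → Set
Primitive A α B β =
  ∀ (α₁ α₂ β₁ β₂ γ δ : List ℕ) (C D : Multiset) →
  IsZm α₁ → IsZm α₂ → IsZm β₁ → IsZm β₂ → IsZm γ → IsZm δ →
  IsNm C → IsNm D → CardAtLeast2 C → CardAtLeast2 D →
  A ≋ dil α₁ C → α ≡ kron γ α₂ → B ≋ dil β₁ D → β ≡ kron δ β₂ →
  kron α₁ α₂ ≡ kron β₁ β₂ →
  (α₁ ≡ 1 ∷ []) × (β₁ ≡ 1 ∷ []) × (α₂ ≡ 1 ∷ []) × (β₂ ≡ 1 ∷ [])

FirstConstruction : Multiset → List ℕ → Multiset → List ℕ → Set
FirstConstruction A α B β =
  Σ (List ℕ) λ α₁ → Σ (List ℕ) λ α₂ → Σ (List ℕ) λ β₁ → Σ (List ℕ) λ β₂ →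
  Σ Multiset λ C →
  IsZm α₁ × IsZm α₂ × IsZm β₁ × IsZm β₂ × IsNm C ×
  kron α₁ α₂ ≡ kron β₁ β₂ × ¬ ((α₁ , α₂) ≡ (β₁ , β₂)) ×
  A ≋ dil α₁ C × α ≡ α₂ × B ≋ dil β₁ C × β ≡ β₂

-- log λ, log λ' linearly independent over ℚ (for λ, λ' ≥ 2):
-- no relation p log λ = q log λ' with (p,q) ≠ (0,0); since both logs
-- are positive, equivalently λ^p = λ'^q with p, q ∈ ℕ forces p = q = 0.

LogIndep : ℕ → ℕ → Set
LogIndep l l' = ∀ (p q : ℕ) → l ^ p ≡ l' ^ q → p ≡ 0 × q ≡ 0

{-# OPTIONS --safe #-}

-- The core is that R C μ = 1 forces the elements of μ to be powers of a single
-- integer g (exact⇒powers).  If X ⊕ W = ℕ and h is the least positive element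
-- of W, then W ⊆ hℕ and X consists of full blocks [qh, qh + h) (de Bruijn).
-- Applied to the summands of μC with g the least element of μ above 1, this
-- peels off one base-g digit at a time: after k digits every element of μ is
-- either g^m with m < k or a multiple of g^k.
--
-- Hence if A = α₁C, α = γα₂, then every element of α₁α₂ is multiplicatively
-- dependent on λ, as α contains a nontrivial power of λ.  If α₁α₂ = β₁β₂ and
-- log λ, log λ′ are independent, all these elements are 1, and uniqueness of
-- representations leaves only (1).  Conversely, λ = g^a and λ′ = g^b make both
-- A and B dilates of S^(g,L) with L = aN · bN′; this needs no explicit form of
-- A and B, because A is determined by α and R A α = 1.  Finally, a solution
-- from the first construction is never primitive since α ≠ (1).

module Submission where

open import Defs
import Algebra.Properties.CommutativeSemigroup
import Data.List.Relation.Binary.Permutation.Propositional.Properties as Perm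
import Data.List.Relation.Unary.All.Properties as All
import Data.Vec.Relation.Unary.All as Vec
open import Algebra.Bundles using (CommutativeSemigroup)
open import Data.Bool using (T; true; false; if_then_else_)
open import Data.Empty using (⊥; ⊥-elim)
open import Data.List using (List; []; _∷_; _++_; map; concatMap; upTo; applyUpTo; length)
open import Data.List.Membership.Propositional using (_∈_)
open import Data.List.Membership.Propositional.Properties
  using (∈-∃++; ∈-map⁺; ∈-map⁻; ∈-++⁺ˡ; ∈-++⁺ʳ; ∈-++⁻)
open import Data.List.Properties
  using (map-∘; map-cong; map-id; map-++; map-upTo; map-applyUpTo; ++-assoc; ++-identityʳ)
open import Data.List.Relation.Binary.Equality.Propositional using (≋⇒≡)
open import Data.List.Relation.Binary.Permutation.Propositional as Perm
  using (_↭_; ↭-refl; ↭-sym; ↭-trans; ↭-reflexive; ↭⇒↭ₛ)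
open import Data.List.Relation.Binary.Permutation.Propositional.Properties using (All-resp-↭; ∈-resp-↭)
open import Data.List.Relation.Unary.All as All using (All; []; _∷_)
open import Data.List.Relation.Unary.Any using (here; there)
open import Data.List.Relation.Unary.Linked using ([-])
open import Data.List.Relation.Unary.Sorted.TotalOrder using (Sorted)
open import Data.List.Relation.Unary.Sorted.TotalOrder.Properties using (↗↭↗⇒≋)
open import Data.Nat hiding (NonTrivial)
open import Data.Nat.Coprimality as Coprime using (Coprime; coprime-divisor; coprime-/gcd)
open import Data.Nat.DivMod
open import Data.Nat.Divisibility
open import Data.Nat.GCD using (gcd; gcd[m,n]∣m; gcd[m,n]∣n; gcd[m,n]≡0⇒m≡0)
open import Data.Nat.Induction using (<-rec)
open import Data.Nat.Properties
open import Data.List.Sort.MergeSort.Properties ≤-decTotalOrder using (sort-↭; sort-↗)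
open import Data.Nat.Solver using (module +-*-Solver)
open import Data.Product using (_×_; _,_; ∃; ∃₂; proj₁; proj₂)
open import Data.Sum using (_⊎_; inj₁; inj₂; [_,_]′)
open import Data.Vec using (Vec; []; _∷_)
open import Function using (_∘_)
open import Function.Bundles using (_⇔_; mk⇔)
open import Level using (0ℓ)
open import Relation.Binary.PropositionalEquality
open import Relation.Nullary using (¬_; contradiction; yes; no)
open import Relation.Nullary.Decidable using (_×-dec_)

-- Guards in the defining sums

if-≤ : ∀ {m n} {v w : ℕ} → m ≤ n → (if m ≤ᵇ n then v else w) ≡ v
if-≤ {m} {n} m≤n with m ≤ᵇ n | ≤⇒≤ᵇ m≤n
... | true | _ = refl

if-> : ∀ {m n} {v w : ℕ} → n < m → (if m ≤ᵇ n then v else w) ≡ w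
if-> {m} {n} n<m with m ≤ᵇ n in eq
... | true  = contradiction (≤ᵇ⇒≤ m n (subst T (sym eq) _)) (<⇒≱ n<m)
... | false = refl

if-0 : ∀ {m n} {v : ℕ} → v ≡ 0 → (if m ≤ᵇ n then v else 0) ≡ 0
if-0 {m} {n} v≡0 with m ≤ᵇ n
... | true  = v≡0
... | false = refl

-- Finite sums

sumTo-cong : ∀ n {f g : ℕ → ℕ} → (∀ {i} → i ≤ n → f i ≡ g i) → sumTo n f ≡ sumTo n g
sumTo-cong zero    e = e ≤-refl
sumTo-cong (suc n) e = cong₂ _+_ (sumTo-cong n (e ∘ m≤n⇒m≤1+n)) (e ≤-refl)

sumTo-zero : ∀ n {f : ℕ → ℕ} → (∀ {i} → i ≤ n → f i ≡ 0) → sumTo n f ≡ 0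
sumTo-zero zero    e = e ≤-refl
sumTo-zero (suc n) e = cong₂ _+_ (sumTo-zero n (e ∘ m≤n⇒m≤1+n)) (e ≤-refl)

sumTo-+ : ∀ n (f g : ℕ → ℕ) → sumTo n (λ i → f i + g i) ≡ sumTo n f + sumTo n g
sumTo-+ zero    f g = refl
sumTo-+ (suc n) f g rewrite sumTo-+ n f g =
  solve 4 (λ a b c d → (a :+ b) :+ (c :+ d) := (a :+ c) :+ (b :+ d)) refl
    (sumTo n f) (sumTo n g) (f (suc n)) (g (suc n))
  where open +-*-Solver

*-distribˡ-sumTo : ∀ c n (f : ℕ → ℕ) → c * sumTo n f ≡ sumTo n (λ i → c * f i)
*-distribˡ-sumTo c zero    f = refl
*-distribˡ-sumTo c (suc n) f =
  trans (*-distribˡ-+ c (sumTo n f) (f (suc n))) (cong (_+ c * f (suc n)) (*-distribˡ-sumTo c n f))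

*-distribʳ-sumTo : ∀ c n (f : ℕ → ℕ) → sumTo n f * c ≡ sumTo n (λ i → f i * c)
*-distribʳ-sumTo c zero    f = refl
*-distribʳ-sumTo c (suc n) f =
  trans (*-distribʳ-+ c (sumTo n f) (f (suc n))) (cong (_+ f (suc n) * c) (*-distribʳ-sumTo c n f))

sumTo-swap : ∀ m n (f : ℕ → ℕ → ℕ) →
  sumTo m (λ i → sumTo n (f i)) ≡ sumTo n (λ j → sumTo m (λ i → f i j))
sumTo-swap zero    n f = refl
sumTo-swap (suc m) n f =
  trans (cong (_+ sumTo n (f (suc m))) (sumTo-swap m n f))
        (sym (sumTo-+ n (λ j → sumTo m (λ i → f i j)) (f (suc m))))

sumTo-extend : ∀ {m n} (f : ℕ → ℕ) → m ≤ n → (∀ {i} → m < i → f i ≡ 0) →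
  sumTo m f ≡ sumTo n f
sumTo-extend f m≤n z = go (≤⇒≤′ m≤n) z
  where
  go : ∀ {m n} → m ≤′ n → (∀ {i} → m < i → f i ≡ 0) → sumTo m f ≡ sumTo n f
  go ≤′-refl                 z = refl
  go (≤′-step {n = n} m≤n) z =
    trans (go m≤n z) (sym (trans (cong (sumTo n f +_) (z (s≤s (≤′⇒≤ m≤n)))) (+-identityʳ _)))

sumTo-single : ∀ {k} n {f : ℕ → ℕ} → k ≤ n → (∀ {i} → i ≤ n → i ≢ k → f i ≡ 0) →
  sumTo n f ≡ f k
sumTo-single zero    z≤n z = refl
sumTo-single {k} (suc n) {f} k≤n z with k ≟ suc n
... | yes refl = cong (_+ f (suc n)) (sumTo-zero n (λ i≤n → z (m≤n⇒m≤1+n i≤n) (<⇒≢ (s≤s i≤n))))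
... | no  k≢   = trans (cong₂ _+_ (sumTo-single n (≤-pred (≤∧≢⇒< k≤n k≢)) (z ∘ m≤n⇒m≤1+n))
                               (z ≤-refl (k≢ ∘ sym))) (+-identityʳ _)

sumTo-shift : ∀ s d (f : ℕ → ℕ) → (∀ {i} → i < s → f i ≡ 0) →
  sumTo (s + d) f ≡ sumTo d (λ z → f (s + z))
sumTo-shift s zero    f z rewrite +-identityʳ s =
  sumTo-single s ≤-refl (λ i≤s i≢s → z (≤∧≢⇒< i≤s i≢s))
sumTo-shift s (suc d) f z rewrite +-suc s d = cong (_+ f (suc (s + d))) (sumTo-shift s d f z)

sumTo-positive : ∀ {k} n {f : ℕ → ℕ} → k ≤ n → 0 < f k → 0 < sumTo n f
sumTo-positive zero    z≤n p = p
sumTo-positive {k} (suc n) {f} k≤n p with k ≟ suc n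
... | yes refl = <-≤-trans p (m≤n+m _ (sumTo n f))
... | no  k≢   = <-≤-trans (sumTo-positive n (≤-pred (≤∧≢⇒< k≤n k≢)) p) (m≤m+n _ _)

sumTo-positive⁻¹ : ∀ n {f : ℕ → ℕ} → 0 < sumTo n f → ∃ λ k → k ≤ n × 0 < f k
sumTo-positive⁻¹ zero    p = 0 , z≤n , p
sumTo-positive⁻¹ (suc n) {f} p with sumTo n f in eq
... | zero  = suc n , ≤-refl , p
... | suc _ with k , k≤n , q ← sumTo-positive⁻¹ n (subst (0 <_) (sym eq) z<s) = k , m≤n⇒m≤1+n k≤n , q

-- Two positive terms at different places already add up to 2. This turns a count equal to 1 into
-- uniqueness of a representation.
sumTo-≡1-unique : ∀ n {f : ℕ → ℕ} {i j} → sumTo n f ≡ 1 → i ≤ n → j ≤ n → 0 < f i → 0 < f j → i ≡ j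
sumTo-≡1-unique zero    e z≤n z≤n p q = refl
sumTo-≡1-unique (suc n) {f} {i} {j} e i≤n j≤n p q with i ≟ suc n | j ≟ suc n
... | yes refl | yes refl = refl
... | yes refl | no  j≢   =
  contradiction (subst (2 ≤_) e (+-mono-≤ (sumTo-positive n (≤-pred (≤∧≢⇒< j≤n j≢)) q) p)) λ { (s≤s ()) }
... | no  i≢   | yes refl =
  contradiction (subst (2 ≤_) e (+-mono-≤ (sumTo-positive n (≤-pred (≤∧≢⇒< i≤n i≢)) p) q)) λ { (s≤s ()) }
... | no  i≢   | no  j≢   =
  sumTo-≡1-unique n (go (sumTo n f) (f (suc n)) (sumTo-positive n i≤n′ p) e) i≤n′ (≤-pred (≤∧≢⇒< j≤n j≢)) p q
  where
  i≤n′ = ≤-pred (≤∧≢⇒< i≤n i≢)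
  go : ∀ s t → 0 < s → s + t ≡ 1 → s ≡ 1
  go (suc zero)    t _ _ = refl
  go (suc (suc s)) t _ ()

-- In terms of generating functions, act a A F = A(z^a) F(z), so that
-- R A (a ∷ α) is act a A (R A α).

act : ℕ → Multiset → Multiset → Multiset
act a A F n = sumTo n (λ x → if a * x ≤ᵇ n then A x * F (n ∸ a * x) else 0)

act-cong : ∀ a {A A′ F F′} → A ≋ A′ → F ≋ F′ → act a A F ≋ act a A′ F′
act-cong a A≋ F≋ n = sumTo-cong n (λ {x} _ →
  cong₂ (λ p q → if a * x ≤ᵇ n then p * q else 0) (A≋ x) (F≋ _))

act-congʳ : ∀ a A {F F′} → F ≋ F′ → act a A F ≋ act a A F′
act-congʳ a A = act-cong a {A} (λ _ → refl)

act-congˡ : ∀ a F {A A′} → A ≋ A′ → act a A F ≋ act a A′ F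
act-congˡ a F e = act-cong a {F = F} e (λ _ → refl)

≋-sym : ∀ {A B} → A ≋ B → B ≋ A
≋-sym e n = sym (e n)

infixr 4 _⟨≋⟩_
_⟨≋⟩_ : ∀ {A B C} → A ≋ B → B ≋ C → A ≋ C
(e ⟨≋⟩ e′) n = trans (e n) (e′ n)

x≤a*x : ∀ {a} → 1 ≤ a → ∀ x → x ≤ a * x
x≤a*x {suc a} _ x = m≤m+n x (a * x)

-- Letting `y` run up to n instead of n - a x makes its range independent of `x`, so that the two
-- sums can be interchanged. The added terms vanish because y ≤ b y.
act-act : ∀ a {b} A B F → 1 ≤ b → ∀ n → act a A (act b B F) n ≡
  sumTo n (λ x → sumTo n (λ y →
    if a * x + b * y ≤ᵇ n then A x * (B y * F (n ∸ (a * x + b * y))) else 0))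
act-act a {b} A B F 1≤b n = sumTo-cong n term
  where
  term : ∀ {x} → x ≤ n → _
  term {x} _ with ≤-<-connex (a * x) n
  ... | inj₂ n<ax = trans (if-> n<ax) (sym (sumTo-zero n (λ _ → if-> (<-≤-trans n<ax (m≤m+n _ _)))))
  ... | inj₁ ax≤n = begin
    (if a * x ≤ᵇ n then A x * sumTo (n ∸ a * x) f else 0) ≡⟨ if-≤ ax≤n ⟩
    A x * sumTo (n ∸ a * x) f ≡⟨ cong (A x *_) (sumTo-extend f (m∸n≤m n (a * x))
                                  (λ lt → if-> (<-≤-trans lt (x≤a*x 1≤b _)))) ⟩
    A x * sumTo n f           ≡⟨ *-distribˡ-sumTo (A x) n f ⟩
    sumTo n (λ y → A x * f y) ≡⟨ sumTo-cong n (λ {y} _ → inner y) ⟩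
    _ ∎
    where
    open ≡-Reasoning
    f = λ y → if b * y ≤ᵇ n ∸ a * x then B y * F (n ∸ a * x ∸ b * y) else 0
    inner : ∀ y → A x * f y ≡ (if a * x + b * y ≤ᵇ n then A x * (B y * F (n ∸ (a * x + b * y))) else 0)
    inner y with ≤-<-connex (b * y) (n ∸ a * x)
    ... | inj₁ le = trans (cong (A x *_) (trans (if-≤ le)
                            (cong (λ k → B y * F k) (∸-+-assoc n (a * x) (b * y)))))
                          (sym (if-≤ (subst (_≤ n) (+-comm (b * y) (a * x)) (m≤o∸n⇒m+n≤o (b * y) ax≤n le))))
    ... | inj₂ gt = trans (cong (A x *_) (if-> gt)) (trans (*-zeroʳ (A x))
                          (sym (if-> (subst (_< a * x + b * y) (m+[n∸m]≡n ax≤n) (+-monoʳ-< (a * x) gt)))))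

act-swap : ∀ {a b} A B F → 1 ≤ a → 1 ≤ b → act a A (act b B F) ≋ act b B (act a A F)
act-swap {a} {b} A B F 1≤a 1≤b n = begin
  act a A (act b B F) n             ≡⟨ act-act a A B F 1≤b n ⟩
  sumTo n (λ x → sumTo n (λ y → _)) ≡⟨ sumTo-swap n n _ ⟩
  sumTo n (λ y → sumTo n (λ x → _)) ≡⟨ sumTo-cong n (λ {y} _ → sumTo-cong n (λ {x} _ → term x y)) ⟩
  sumTo n (λ y → sumTo n (λ x → _)) ≡⟨ act-act b B A F 1≤a n ⟨
  act b B (act a A F) n             ∎
  where
  open ≡-Reasoning
  open +-*-Solver
  term : ∀ x y → (if a * x + b * y ≤ᵇ n then A x * (B y * F (n ∸ (a * x + b * y))) else 0) ≡
                 (if b * y + a * x ≤ᵇ n then B y * (A x * F (n ∸ (b * y + a * x))) else 0)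
  term x y rewrite +-comm (a * x) (b * y) = cong (λ k → if b * y + a * x ≤ᵇ n then k else 0)
    (solve 3 (λ p q r → p :* (q :* r) := q :* (p :* r)) refl (A x) (B y) (F (n ∸ (b * y + a * x))))

-- As generating functions both sides are C(z^(ab)) G(z^a) F(z). The proof exchanges the sums and
-- substitutes x = b y + z.
act-assoc : ∀ {a b} C G F → 1 ≤ a → 1 ≤ b → act a (act b C G) F ≋ act (a * b) C (act a G F)
act-assoc {a} {b} C G F 1≤a 1≤b n = begin
  act a (act b C G) F n                                     ≡⟨ sumTo-cong n expand ⟩
  sumTo n (λ x → sumTo n (λ y → H x y))                     ≡⟨ sumTo-swap n n H ⟩
  sumTo n (λ y → sumTo n (λ x → H x y))                     ≡⟨ sumTo-cong n (λ {y} _ → reindex y) ⟩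
  sumTo n (λ y → sumTo n (λ z → K y z))                     ≡⟨ act-act (a * b) C G F 1≤a n ⟨
  act (a * b) C (act a G F) n                               ∎
  where
  open ≡-Reasoning
  H K : ℕ → ℕ → ℕ
  H x y = if a * x ≤ᵇ n then (if b * y ≤ᵇ x then C y * G (x ∸ b * y) else 0) * F (n ∸ a * x) else 0
  K y z = if a * b * y + a * z ≤ᵇ n then C y * (G z * F (n ∸ (a * b * y + a * z))) else 0

  expand : ∀ {x} → x ≤ n → (if a * x ≤ᵇ n then act b C G x * F (n ∸ a * x) else 0) ≡ sumTo n (H x)
  expand {x} x≤n with ≤-<-connex (a * x) n
  ... | inj₂ gt = trans (if-> gt) (sym (sumTo-zero n (λ _ → if-> gt)))
  ... | inj₁ le = trans (if-≤ le) (trans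
      (cong (_* F (n ∸ a * x)) (sumTo-extend _ x≤n (λ lt → if-> (<-≤-trans lt (x≤a*x 1≤b _)))))
      (trans (*-distribʳ-sumTo (F (n ∸ a * x)) n _) (sumTo-cong n (λ _ → sym (if-≤ le)))))

  dist : ∀ y z → a * (b * y + z) ≡ a * b * y + a * z
  dist y z = trans (*-distribˡ-+ a (b * y) z) (cong (_+ a * z) (sym (*-assoc a b y)))

  HK : ∀ y z → H (b * y + z) y ≡ K y z
  HK y z rewrite dist y z with ≤-<-connex (a * b * y + a * z) n
  ... | inj₂ gt = trans (if-> gt) (sym (if-> gt))
  ... | inj₁ le = trans (if-≤ le) (trans (cong (_* F _) (trans (if-≤ (m≤m+n (b * y) z))
                    (cong (λ k → C y * G k) (m+n∸m≡n (b * y) z))))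
                    (trans (*-assoc (C y) _ _) (sym (if-≤ le))))

  reindex : ∀ y → sumTo n (λ x → H x y) ≡ sumTo n (K y)
  reindex y with ≤-<-connex (b * y) n
  ... | inj₂ gt = trans (sumTo-zero n (λ i≤n → if-0 {a * _} {n} (cong (_* F _) (if-> {b * y} (≤-<-trans i≤n gt)))))
                        (sym (sumTo-zero n (λ {z} _ → if-> (<-≤-trans gt (≤-trans
                          (subst (b * y ≤_) (sym (*-assoc a b y)) (x≤a*x 1≤a _)) (m≤m+n _ (a * z)))))))
  -- The terms with x < b y vanish. So do those of `K y` beyond n - b y, since there n < b y + z ≤ a
  -- (b y + z).
  ... | inj₁ le = begin
    sumTo n (λ x → H x y)                     ≡⟨ cong (λ k → sumTo k (λ x → H x y)) (m+[n∸m]≡n le) ⟨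
    sumTo (b * y + (n ∸ b * y)) (λ x → H x y) ≡⟨ sumTo-shift (b * y) (n ∸ b * y) (λ x → H x y)
                                                  (λ lt → if-0 {a * _} {n} (cong (_* F _) (if-> {b * y} lt))) ⟩
    sumTo (n ∸ b * y) (λ z → H (b * y + z) y) ≡⟨ sumTo-cong (n ∸ b * y) (λ {z} _ → HK y z) ⟩
    sumTo (n ∸ b * y) (K y)                   ≡⟨ sumTo-extend (K y) (m∸n≤m n (b * y)) (λ lt → if-> (big lt)) ⟩
    sumTo n (K y)                             ∎
    where
    big : ∀ {z} → n ∸ b * y < z → n < a * b * y + a * z
    big {z} lt = <-≤-trans (subst (_< b * y + z) (m+[n∸m]≡n le) (+-monoʳ-< (b * y) lt))
                   (subst (b * y + z ≤_) (dist y z) (x≤a*x 1≤a (b * y + z)))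

≋-refl : ∀ {A} → A ≋ A
≋-refl _ = refl

-- Unit, intervals and scaling

δ : Multiset
δ n = if n ≡ᵇ 0 then 1 else 0

box : ℕ → Multiset
box m n = if n <ᵇ m then 1 else 0

if-< : ∀ {m n} {v w : ℕ} → m < n → (if m <ᵇ n then v else w) ≡ v
if-< {m} {n} m<n with m <ᵇ n | <⇒<ᵇ m<n
... | true | _ = refl

if-≥ : ∀ {m n} {v w : ℕ} → n ≤ m → (if m <ᵇ n then v else w) ≡ w
if-≥ {m} {n} n≤m with m <ᵇ n in eq
... | true  = contradiction (<ᵇ⇒< m n (subst T (sym eq) _)) (≤⇒≯ n≤m)
... | false = refl

-- A term survives only if n - K i lies in [0, m), which is contained in [0, K). This forces i = n /
-- K and leaves the remainder n % K.
act-box : ∀ {m} K .{{_ : NonZero K}} F → m ≤ K → ∀ n →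
  act K F (box m) n ≡ (if n % K <ᵇ m then F (n / K) else 0)
act-box {m} K F m≤K n = trans (sumTo-single n (m/n≤m n K) others) (trans (if-≤ K*q≤n) main)
  where
  K*q≤n : K * (n / K) ≤ n
  K*q≤n = subst (_≤ n) (*-comm (n / K) K) (m/n*n≤m n K)
  others : ∀ {i} → i ≤ n → i ≢ n / K → (if K * i ≤ᵇ n then F i * box m (n ∸ K * i) else 0) ≡ 0
  others {i} _ i≢ with ≤-<-connex (K * i) n
  ... | inj₂ gt = if-> gt
  ... | inj₁ le = if-0 {K * i} {n} (trans (cong (F i *_) (if-≥ {n ∸ K * i} (≤-trans m≤K
                    (m+n≤o⇒m≤o∸n K (≤-trans (≤-reflexive (sym (*-suc K i)))
                      (≤-trans (*-monoʳ-≤ K i<q) K*q≤n)))))) (*-zeroʳ (F i)))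
    where
    i<q : i < n / K
    i<q = ≤∧≢⇒< (subst (_≤ n / K) (trans (cong (_/ K) (*-comm K i)) (m*n/n≡m i K)) (/-monoˡ-≤ K le)) i≢
  main : F (n / K) * box m (n ∸ K * (n / K)) ≡ (if n % K <ᵇ m then F (n / K) else 0)
  main rewrite *-comm K (n / K) | sym (m%n≡m∸m/n*n n K) with n % K <ᵇ m
  ... | true  = *-identityʳ _
  ... | false = *-zeroʳ (F (n / K))

act-box-full : ∀ g .{{_ : NonZero g}} F → ∀ n → act g F (box g) n ≡ F (n / g)
act-box-full g F n = trans (act-box g F ≤-refl n) (if-< (m%n<n n g))

box1≋δ : box 1 ≋ δ
box1≋δ zero    = refl
box1≋δ (suc n) = refl

scale : ℕ → Multiset → Multiset
scale a F = act a F δ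

scale-≡ : ∀ a .{{_ : NonZero a}} F n → scale a F n ≡ (if n % a <ᵇ 1 then F (n / a) else 0)
scale-≡ a F n = trans (act-congʳ a F (≋-sym box1≋δ) n) (act-box a F (>-nonZero⁻¹ a) n)

scale-* : ∀ a .{{_ : NonZero a}} F n → scale a F (a * n) ≡ F n
scale-* a F n rewrite *-comm a n =
  trans (scale-≡ a F (n * a)) (trans (cong (λ k → if k <ᵇ 1 then F (n * a / a) else 0) (m*n%n≡0 n a))
    (cong F (m*n/n≡m n a)))

scale-∤ : ∀ a .{{_ : NonZero a}} F {n} → a ∤ n → scale a F n ≡ 0
scale-∤ a F {n} a∤n = trans (scale-≡ a F n) (if-≥ (n≢0⇒n>0 (a∤n ∘ m%n≡0⇒n∣m n a)))

scale-positive : ∀ a .{{_ : NonZero a}} {F n} → 0 < scale a F n → ∃ λ c → n ≡ a * c × 0 < F c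
scale-positive a {F} {n} p with a ∣? n
... | no a∤n = contradiction (scale-∤ a F a∤n) (>⇒≢ p)
... | yes (divides q refl) = q , *-comm q a , subst (0 <_)
        (trans (cong (scale a F) (*-comm q a)) (scale-* a F q)) p

scale-1 : ∀ F → scale 1 F ≋ F
scale-1 F n = trans (cong (scale 1 F) (sym (*-identityˡ n))) (scale-* 1 F n)

act-δ : ∀ a F → act a δ F ≋ F
act-δ a F n = trans
  (sumTo-single {0} n z≤n λ { {zero} _ z → ⊥-elim (z refl) ; {suc i} _ _ → if-0 {a * suc i} {n} refl })
  (trans (if-≤ (subst (_≤ n) (sym (*-zeroʳ a)) z≤n))
    (trans (*-identityˡ _) (cong (λ k → F (n ∸ k)) (*-zeroʳ a))))

-- Convolution

infixr 25 _⊛_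
_⊛_ : Multiset → Multiset → Multiset
_⊛_ = act 1

⊛-≡ : ∀ X W n → (X ⊛ W) n ≡ sumTo n (λ x → X x * W (n ∸ x))
⊛-≡ X W n = sumTo-cong n (λ {x} x≤n → trans (if-≤ {1 * x} {n} (subst (_≤ n) (sym (*-identityˡ x)) x≤n))
                                   (cong (λ k → X x * W (n ∸ k)) (*-identityˡ x)))

⊛-comm : ∀ X W → X ⊛ W ≋ W ⊛ X
⊛-comm X W = act-congʳ 1 X (≋-sym (scale-1 W)) ⟨≋⟩ act-swap X W δ ≤-refl ≤-refl
  ⟨≋⟩ act-congʳ 1 W (scale-1 X)

-- Lets `act` be read as a convolution with the dilated multiset, so that facts about sums of two
-- multisets apply to it.
⊛-scale : ∀ a .{{_ : NonZero a}} A F → scale a A ⊛ F ≋ act a A F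
⊛-scale a A F = act-assoc A δ F ≤-refl (>-nonZero⁻¹ a) ⟨≋⟩
  (λ n → cong (λ b → act b A (δ ⊛ F) n) (*-identityˡ a)) ⟨≋⟩ act-congʳ a A (act-δ 1 F)

⊛-positive : ∀ {X W a b} → 0 < X a → 0 < W b → 0 < (X ⊛ W) (a + b)
⊛-positive {X} {W} {a} {b} p q = subst (0 <_) (sym (⊛-≡ X W (a + b)))
  (sumTo-positive (a + b) (m≤m+n a b) (*-mono-≤ p (subst (λ k → 0 < W k) (sym (m+n∸m≡n a b)) q)))

*-positive⁻¹ : ∀ m n → 0 < m * n → 0 < m × 0 < n
*-positive⁻¹ (suc m) (suc n) _ = z<s , z<s
*-positive⁻¹ (suc m) zero    p = contradiction p (subst (λ k → 0 ≮ k) (sym (*-zeroʳ m)) λ ())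

⊛-positive⁻¹ : ∀ {X W n} → 0 < (X ⊛ W) n → ∃₂ λ a b → n ≡ a + b × 0 < X a × 0 < W b
⊛-positive⁻¹ {X} {W} {n} p with a , a≤n , q ← sumTo-positive⁻¹ n (subst (0 <_) (⊛-≡ X W n) p)
  with r , s ← *-positive⁻¹ (X a) _ q = a , n ∸ a , sym (m+[n∸m]≡n a≤n) , r , s

-- The coefficient at a + b is a sum equal to 1 in which both `a` and `c` index positive terms.
⊛-unique : ∀ {X W a b c d} → (X ⊛ W) (a + b) ≡ 1 → 0 < X a → 0 < W b → 0 < X c → 0 < W d →
  a + b ≡ c + d → a ≡ c × b ≡ d
⊛-unique {X} {W} {a} {b} {c} {d} e p q r s a+b≡c+d = a≡c , +-cancelˡ-≡ a b d (trans a+b≡c+d (cong (_+ d) (sym a≡c)))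
  where
  a≡c : a ≡ c
  a≡c = sumTo-≡1-unique (a + b) (trans (sym (⊛-≡ X W (a + b))) e)
    (m≤m+n a b) (subst (c ≤_) (sym a+b≡c+d) (m≤m+n c d))
    (*-mono-≤ p (subst (λ k → 0 < W k) (sym (m+n∸m≡n a b)) q))
    (*-mono-≤ r (subst (λ k → 0 < W k) (sym (trans (cong (_∸ c) a+b≡c+d) (m+n∸m≡n c d))) s))

-- Coefficients are compared from the bottom up: the one at n is F n * V 0 plus terms in F below n.
-- `V` and `V′` may themselves depend on `F` and `F′`, hence their agreement up to n is asked for
-- only once `F` and `F′` agree below n.
⊛-cancel : ∀ {F F′ V V′} → V 0 ≡ 1 → V′ 0 ≡ 1 →
  (∀ n → 0 < n → (∀ {i} → i < n → F i ≡ F′ i) → ∀ {m} → m ≤ n → V m ≡ V′ m) →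
  F ⊛ V ≋ F′ ⊛ V′ → F ≋ F′
⊛-cancel {F} {F′} {V} {V′} v v′ agree e = <-rec _ step
  where
  top : ∀ x → F x * V 0 ≡ F′ x * V′ 0 → F x ≡ F′ x
  top x eq = trans (sym (*-identityʳ _)) (trans (cong (F x *_) (sym v)) (trans eq
           (trans (cong (F′ x *_) v′) (*-identityʳ _))))
  step : ∀ n → (∀ {i} → i < n → F i ≡ F′ i) → F n ≡ F′ n
  step zero    _  = top 0 (trans (sym (⊛-≡ F V 0)) (trans (e 0) (⊛-≡ F′ V′ 0)))
  step (suc k) ih = top (suc k) (subst (λ z → F (suc k) * V z ≡ F′ (suc k) * V′ z) (n∸n≡0 k)
    (+-cancelˡ-≡ (sumTo k (λ x → F x * V (suc k ∸ x))) _ _ (trans (sym (⊛-≡ F V (suc k)))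
      (trans (e (suc k)) (trans (⊛-≡ F′ V′ (suc k)) (cong (_+ F′ (suc k) * V′ (k ∸ k)) (sumTo-cong k
        λ {x} x≤k → cong₂ _*_ (sym (ih (s≤s x≤k))) (sym (agree (suc k) z<s ih (m∸n≤m (suc k) x))))))))) )

-- The functions R

R-cong : ∀ {A A′} → A ≋ A′ → ∀ α → R A α ≋ R A′ α
R-cong e []      = ≋-refl
R-cong e (a ∷ α) = act-cong a e (R-cong e α)

R-↭ : ∀ A {α β} → All (1 ≤_) α → α ↭ β → R A α ≋ R A β
R-↭ A p             Perm.refl         = ≋-refl
R-↭ A (_ ∷ p)       (Perm.prep x e)   = act-congʳ x A (R-↭ A p e)
R-↭ A (px ∷ py ∷ p) (Perm.swap {xs = xs} x y e) =
  act-swap A A (R A xs) px py ⟨≋⟩ act-congʳ y A (act-congʳ x A (R-↭ A p e))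
R-↭ A p             (Perm.trans e e′) = R-↭ A p e ⟨≋⟩ R-↭ A (All-resp-↭ e p) e′

R-map-++ : ∀ C {a β} ρ → 1 ≤ a → All (1 ≤_) β → R C (map (a *_) β ++ ρ) ≋ act a (R C β) (R C ρ)
R-map-++ C {a} ρ 1≤a []              = ≋-sym (act-δ a (R C ρ))
R-map-++ C {a} {b ∷ β} ρ 1≤a (1≤b ∷ p) =
  act-congʳ (a * b) C (R-map-++ C ρ 1≤a p) ⟨≋⟩ ≋-sym (act-assoc C (R C β) (R C ρ) 1≤a 1≤b)

infixr 25 _⊗_
_⊗_ : List ℕ → List ℕ → List ℕ
α ⊗ β = concatMap (λ a → map (a *_) β) α

-- Successive dilations multiply their coefficients: (αβ)C = α(βC). This passes from A to C when A
-- is a dilate of C.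
R-⊗ : ∀ C {α β} → All (1 ≤_) α → All (1 ≤_) β → R C (α ⊗ β) ≋ R (R C β) α
R-⊗ C []                      q = ≋-refl
R-⊗ C {a ∷ α} {β} (1≤a ∷ p) q = R-map-++ C (α ⊗ β) 1≤a q ⟨≋⟩ act-congʳ a (R C β) (R-⊗ C p q)

R-zero : ∀ A {α} → A 0 ≡ 1 → R A α 0 ≡ 1
R-zero A {[]}    A₀ = refl
R-zero A {a ∷ α} A₀ rewrite *-zeroʳ a | A₀ = trans (+-identityʳ _) (R-zero A {α} A₀)

R-zero⁻¹ : ∀ A {α} → (∀ n → R A α n ≡ 1) → A 0 ≡ 1
R-zero⁻¹ A {[]}    e = contradiction (e 1) λ ()
R-zero⁻¹ A {a ∷ α} e = m*n≡1⇒m≡1 (A 0) _ (trans (sym (if-≤ (subst (_≤ 0) (sym (*-zeroʳ a)) z≤n))) (e 0))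

-- With every entry at least 2, a value `A x` that contributes at m ≤ n has 2 x ≤ n, so x < n.
R-agree : ∀ {A A′} n → 0 < n → (∀ {i} → i < n → A i ≡ A′ i) → ∀ {α} → All (2 ≤_) α →
  ∀ {m} → m ≤ n → R A α m ≡ R A′ α m
R-agree         n 0<n ag []                      m≤n = refl
R-agree {A} {A′} n 0<n ag {a ∷ α} (2≤a ∷ p) {m} m≤n = sumTo-cong m term
  where
  x<n : ∀ x → a * x ≤ m → x < n
  x<n zero    _  = 0<n
  x<n (suc x) le = <-≤-trans (subst (suc x <_) (*-comm (suc x) a) (m<m*n (suc x) a 2≤a)) (≤-trans le m≤n)
  term : ∀ {x} → x ≤ m → (if a * x ≤ᵇ m then A x * R A α (m ∸ a * x) else 0) ≡
                         (if a * x ≤ᵇ m then A′ x * R A′ α (m ∸ a * x) else 0)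
  term {x} _ with ≤-<-connex (a * x) m
  ... | inj₂ gt = trans (if-> gt) (sym (if-> gt))
  ... | inj₁ le = trans (if-≤ le) (trans (cong₂ _*_ (ag (x<n x le))
                    (R-agree n 0<n ag p (≤-trans (m∸n≤m m (a * x)) m≤n))) (sym (if-≤ le)))

ones : List ℕ → ℕ
ones []                  = 0
ones (zero ∷ α)          = ones α
ones (suc zero ∷ α)      = suc (ones α)
ones (suc (suc _) ∷ α)   = ones α

-- A sum equal to 1 has a single nonzero summand, which must be 1 times 1 and so sits at an entry 1
-- of α.
R-one : ∀ A {α} → A 0 ≡ 1 → All (1 ≤_) α → R A α 1 ≡ ones α * A 1
R-one A A₀ [] = refl
R-one A {suc zero ∷ α} A₀ (_ ∷ p) rewrite A₀ | R-zero A {α} A₀ | R-one A A₀ p =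
  trans (cong₂ _+_ (+-identityʳ (ones α * A 1)) (*-identityʳ (A 1))) (+-comm (ones α * A 1) (A 1))
R-one A {suc (suc a) ∷ α} A₀ (_ ∷ p) rewrite *-zeroʳ a | A₀ | R-one A A₀ p =
  trans (+-identityʳ _) (+-identityʳ _)

ones≡0 : ∀ {α} → All (1 ≤_) α → ones α ≡ 0 → All (2 ≤_) α
ones≡0 [] e = []
ones≡0 {suc (suc _) ∷ α} (_ ∷ p) e = s≤s (s≤s z≤n) ∷ ones≡0 p e

ones≡1 : ∀ {α} → All (1 ≤_) α → ones α ≡ 1 → ∃ λ ρ → α ↭ 1 ∷ ρ × All (2 ≤_) ρ
ones≡1 {suc zero ∷ α} (_ ∷ p) e = α , ↭-refl , ones≡0 p (suc-injective e)
ones≡1 {suc (suc a) ∷ α} (_ ∷ p) e with ρ , α↭ , q ← ones≡1 p e =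
  suc (suc a) ∷ ρ , ↭-trans (Perm.prep _ α↭) (Perm.swap _ _ ↭-refl) , s≤s (s≤s z≤n) ∷ q

Exact : Multiset → Set
Exact X = ∀ n → X n ≡ 1

module _ {A : Multiset} {α : List ℕ} (p : All (1 ≤_) α) (e : Exact (R A α)) where

  private
    product : ones α * A 1 ≡ 1
    product = trans (sym (R-one A (R-zero⁻¹ A {α} e) p)) (e 1)

  -- The value at 1 is `ones α * A 1`, and a product of naturals equal to 1 has both factors 1.
  exact-ones : ones α ≡ 1
  exact-ones = m*n≡1⇒m≡1 (ones α) (A 1) product

  exact-one : A 1 ≡ 1
  exact-one = m*n≡1⇒n≡1 (ones α) (A 1) product

-- Structure of X and W when X ⊕ W = ℕ

Multiples Block : ℕ → Multiset → Set
Multiples h X = ∀ {n} → 0 < X n → h ∣ n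
Block h X = ∀ q {r} → r < h → X (q * h + r) ≡ X (q * h)

module _ {X W : Multiset} (exact : Exact (X ⊛ W)) (X₀ : 0 < X 0) (W₀ : 0 < W 0) where

  private
    represent : ∀ n → ∃₂ λ a b → n ≡ a + b × 0 < X a × 0 < W b
    represent n = ⊛-positive⁻¹ (subst (0 <_) (sym (exact n)) z<s)

    unique : ∀ {a b c d} → 0 < X a → 0 < W b → 0 < X c → 0 < W d → a + b ≡ c + d → a ≡ c × b ≡ d
    unique {a} {b} = ⊛-unique (exact (a + b))

  -- n + 0 and 0 + n would be two representations of n.
  disjoint : ∀ {n} → 0 < n → 0 < X n → 0 < W n → ∀ {A : Set} → A
  disjoint {n} 0<n p q = contradiction (proj₁ (unique p W₀ X₀ q (+-comm n 0))) (>⇒≢ 0<n)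

  -- X n * W 0 is one of the terms that add up to (X ⊛ W) n = 1.
  ≤1 : ∀ n → X n ≤ 1
  ≤1 n = begin
    X n             ≡⟨ *-identityʳ (X n) ⟨
    X n * 1         ≤⟨ *-monoʳ-≤ (X n) W₀ ⟩
    X n * W 0       ≡⟨ cong (λ k → X n * W k) (n∸n≡0 n) ⟨
    X n * W (n ∸ n) ≤⟨ le n ⟩
    sumTo n (λ x → X x * W (n ∸ x)) ≡⟨ ⊛-≡ X W n ⟨
    (X ⊛ W) n       ≡⟨ exact n ⟩
    1               ∎
    where
    open ≤-Reasoning
    le : ∀ n {f} → f n ≤ sumTo n f
    le zero    = ≤-refl
    le (suc n) {f} = m≤n+m (f (suc n)) (sumTo n f)

  -- Suppose n in W has remainder r > 0, and write the multiple of h below n as a + b. By induction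
  -- h divides b, hence also a, so the block of `a` contains a + r. Then (a + r) + b and 0 + n are
  -- two representations of n.
  block⇒multiples : ∀ {h} .{{_ : NonZero h}} → Block h X → Multiples h W
  block⇒multiples {h} block = <-rec _ step _
    where
    step : ∀ n → (∀ {m} → m < n → 0 < W m → h ∣ m) → 0 < W n → h ∣ n
    step n ih Wn with n % h in r≡
    ... | zero  = m%n≡0⇒n∣m n h r≡
    ... | suc r with a , b , qh≡ , Xa , Wb ← represent (n / h * h) =
      contradiction (proj₁ (unique X[a+r] Wb X₀ Wn sum)) (λ z → contradiction (trans (sym (+-suc a r)) z) λ ())
      where
      n≡ : n ≡ suc r + n / h * h
      n≡ = trans (m≡m%n+[m/n]*n n h) (cong (_+ n / h * h) r≡)
      h∣b : h ∣ b
      h∣b = ih (≤-<-trans (subst (b ≤_) (sym qh≡) (m≤n+m b a)) (subst (n / h * h <_) (sym n≡) (s≤s (m≤n+m _ r)))) Wb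
      h∣a : h ∣ a
      h∣a = ∣m+n∣m⇒∣n (subst (h ∣_) (trans qh≡ (+-comm a b)) (n∣m*n (n / h))) h∣b
      X[a+r] : 0 < X (a + suc r)
      X[a+r] with divides q refl ← h∣a = subst (0 <_) (sym (block q (subst (_< h) r≡ (m%n<n n h)))) Xa
      sum : a + suc r + b ≡ 0 + n
      sum = trans (cong (_+ b) (+-comm a (suc r))) (trans (+-assoc (suc r) a b)
              (trans (cong (suc r +_) (sym qh≡)) (sym n≡)))

  module _ {h : ℕ} .{{_ : NonZero h}} (Wh : 0 < W h) (least : ∀ {m} → 0 < W m → m < h → m ≡ 0) where

    private
      0<h : 0 < h
      0<h = >-nonZero⁻¹ h

      small : ∀ {m} → m < h → 0 < X m
      small {m} m<h with a , b , refl , Xa , Wb ← represent m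
        with refl ← least Wb (≤-<-trans (m≤n+m b a) m<h) = subst (λ k → 0 < X k) (sym (+-identityʳ a)) Xa

      -- The three claims about the row [i h, i h + h) go through one strong induction, as each
      -- draws on the others in earlier rows.
      Row : ℕ → Set
      Row i = ∀ {r} → r < h → (0 < W (i * h + r) → r ≡ 0) ×
        (0 < X (i * h + r) → 0 < X (i * h)) × (0 < X (i * h) → 0 < X (i * h + r))

      j*h≢0 : ∀ j → suc j * h ≢ 0
      j*h≢0 j = m<n⇒n≢0 (<-≤-trans 0<h (m≤m+n h (j * h)))

      divide : ∀ b → b ≡ b / h * h + b % h
      divide b = trans (m≡m%n+[m/n]*n b h) (+-comm (b % h) _)

      regroup : ∀ i′ j r → i′ * h + r + j * h ≡ (j + i′) * h + r
      regroup i′ j r = trans (trans (+-comm _ (j * h)) (sym (+-assoc (j * h) (i′ * h) r)))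
                             (cong (_+ r) (sym (*-distribʳ-+ h j i′)))

      row : ∀ i → (∀ {i′} → i′ < i → Row i′) → Row i
      row i ih = λ r<h → offset r<h , left r<h , right r<h
        where
        multiple : ∀ {b} → 0 < W b → b / h < i → ∃ λ j → j < i × b ≡ j * h
        multiple {b} Wb lt = b / h , lt , trans (divide b) (trans (cong (b / h * h +_)
          (proj₁ (ih lt (m%n<n b h)) (subst (λ k → 0 < W k) (divide b) Wb))) (+-identityʳ _))

        -- The shapes that a representation of i h can take once the members of W in earlier rows
        -- are known to be multiples of h.
        Start : ℕ → Set
        Start i = 0 < X (i * h) ⊎ ∃₂ λ i′ j → suc j + i′ ≡ i × 0 < X (i′ * h) × 0 < W (suc j * h)

        trivial : ∀ i → 0 < W (i * h) → Start i
        trivial zero    _ = inj₁ X₀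
        trivial (suc i) w = inj₂ (0 , i , +-identityʳ (suc i) , X₀ , w)

        start : Start i
        start with a , b , ih≡ , Xa , Wb ← represent (i * h) with m≤n⇒m<n∨m≡n (m+n≤o⇒n≤o a (≤-reflexive (sym ih≡)))
        ... | inj₂ refl = trivial i Wb
        ... | inj₁ lt with multiple Wb (m<n*o⇒m/o<n lt)
        ... | zero  , _ , refl = inj₁ (subst (λ k → 0 < X k) (trans (sym (+-identityʳ a)) (sym ih≡)) Xa)
        ... | suc j , j<i , refl with i′ , refl ← m≤n⇒∃[o]m+o≡n (<⇒≤ j<i) =
          inj₂ (i′ , j , refl , subst (λ k → 0 < X k) (+-cancelʳ-≡ (suc j * h) a (i′ * h) (trans (sym ih≡)
            (trans (*-distribʳ-+ h (suc j) i′) (+-comm (suc j * h) _)))) Xa , Wb)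

        offset : ∀ {r} → r < h → 0 < W (i * h + r) → r ≡ 0
        offset {r} r<h W[ih+r] with start
        -- By an earlier row i′ h + r is in X. Comparing (i′ h + r) + (j + 1) h with 0 + (i h + r)
        -- gives i′ h + r = 0.
        ... | inj₂ (i′ , j , refl , Xi′ , Wj) = m+n≡0⇒n≡0 (i′ * h) (proj₁
            (unique (proj₂ (proj₂ (ih (s≤s (m≤n+m i′ j)) r<h)) Xi′) Wj X₀ W[ih+r] (regroup i′ (suc j) r)))
        ... | inj₁ Xi = self i r<h W[ih+r] Xi
          where
          self : ∀ i {r} → r < h → 0 < W (i * h + r) → 0 < X (i * h) → r ≡ 0
          self i       {zero}  r<h W[ih+r] Xi = refl
          self zero    {suc r} r<h W[ih+r] Xi = least W[ih+r] r<h
          -- For an offset r > 0 in a row i > 0, the sums (h - r) + (i h + r) and i h + h agree,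
          -- although h - r < h ≤ i h.
          self (suc i) {suc r} r<h W[ih+r] Xi = contradiction (proj₁ (unique (small lt) W[ih+r] Xi Wh
            (trans (+-comm (h ∸ suc r) _) (trans (+-assoc (suc i * h) (suc r) _)
              (cong (suc i * h +_) (m+[n∸m]≡n (<⇒≤ r<h)))))))
            (<⇒≢ (<-≤-trans lt (m≤m+n h (i * h))))
            where
            lt : h ∸ suc r < h
            lt = ∸-monoʳ-< z<s (<⇒≤ r<h)

        left : ∀ {r} → r < h → 0 < X (i * h + r) → 0 < X (i * h)
        left {r} r<h X[ih+r] with start
        ... | inj₁ Xi = Xi
        -- Here i′ h + r is in X, so (i′ h + r) + (j + 1) h and (i h + r) + 0 would be two
        -- representations.
        ... | inj₂ (i′ , j , refl , Xi′ , Wj) = contradiction (proj₂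
            (unique (proj₂ (proj₂ (ih (s≤s (m≤n+m i′ j)) r<h)) Xi′) Wj X[ih+r] W₀
              (trans (regroup i′ (suc j) r) (sym (+-identityʳ _))))) (j*h≢0 j)

        right : ∀ {r} → r < h → 0 < X (i * h) → 0 < X (i * h + r)
        right {r} r<h Xi with a , b , eq , Xa , Wb ← represent (i * h + r) with go
          where
          lt : b / h < suc i
          lt = m<n*o⇒m/o<n (≤-<-trans (m+n≤o⇒n≤o a (≤-reflexive (sym eq)))
                 (subst (i * h + r <_) (+-comm (i * h) h) (+-monoʳ-< (i * h) r<h)))
          go : ∃ λ j → j ≤ i × b ≡ j * h
          go with m≤n⇒m<n∨m≡n (≤-pred lt)
          ... | inj₁ b/h<i with j , j<i , b≡ ← multiple Wb b/h<i = j , <⇒≤ j<i , b≡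
          ... | inj₂ refl = i , ≤-refl , trans (divide b) (trans (cong (b / h * h +_)
                  (offset (m%n<n b h) (subst (λ k → 0 < W k) (divide b) Wb))) (+-identityʳ _))
        ... | zero  , _   , refl = subst (λ k → 0 < X k) (trans (sym (+-identityʳ a)) (sym eq)) Xa
        -- The part in X is i′ h + r, so i′ h is in X by an earlier row, and i′ h + (j + 1) h
        -- competes with i h + 0.
        ... | suc j , j<i , refl with i′ , refl ← m≤n⇒∃[o]m+o≡n j<i = contradiction (proj₂
            (unique (proj₁ (proj₂ (ih (s≤s (m≤n+m i′ j)) r<h)) (subst (λ k → 0 < X k)
              (+-cancelʳ-≡ (suc j * h) a _ (trans (sym eq) (sym (regroup i′ (suc j) r)))) Xa)) Wj Xi W₀
              (trans (+-comm (i′ * h) _) (trans (sym (*-distribʳ-+ h (suc j) i′)) (sym (+-identityʳ _)))))) (j*h≢0 j)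
          where Wj = Wb

      rows : ∀ i → Row i
      rows = <-rec Row row

    least⇒multiples : Multiples h W
    least⇒multiples {n} Wn = m%n≡0⇒n∣m n h
      (proj₁ (rows (n / h) (m%n<n n h)) (subst (λ k → 0 < W k) (divide n) Wn))

    least⇒block : Block h X
    -- Both values are at most 1, so it is enough that one is positive exactly when the other is.
    least⇒block q {r} r<h = same (≤1 (q * h + r)) (≤1 (q * h))
        (proj₁ (proj₂ (rows q r<h))) (proj₂ (proj₂ (rows q r<h)))
      where
      same : ∀ {m n} → m ≤ 1 → n ≤ 1 → (0 < m → 0 < n) → (0 < n → 0 < m) → m ≡ n
      same z≤n       z≤n       _ _ = refl
      same z≤n       (s≤s z≤n) _ f = contradiction (f z<s) λ ()
      same (s≤s z≤n) z≤n       f _ = contradiction (f z<s) λ ()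
      same (s≤s z≤n) (s≤s z≤n) _ _ = refl

-- Least elements and factors of scaled multisets

∈⇒↭ : ∀ {x : ℕ} {xs} → x ∈ xs → ∃ λ ys → xs ↭ x ∷ ys
∈⇒↭ {x} x∈ with ys , zs , refl ← ∈-∃++ x∈ = ys ++ zs , Perm.shift x ys zs

n<g^n : ∀ {g} → 2 ≤ g → ∀ n → n < g ^ n
n<g^n {g} 2≤g zero    = z<s
n<g^n {g} 2≤g (suc n) = begin-strict
  suc n         ≤⟨ n<g^n 2≤g n ⟩
  g ^ n         <⟨ m<m*n (g ^ n) g {{>-nonZero (≤-<-trans z≤n (n<g^n 2≤g n))}} 2≤g ⟩
  g ^ n * g     ≡⟨ *-comm (g ^ n) g ⟩
  g * g ^ n     ∎
  where open ≤-Reasoning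

leastPositive : ∀ (X : Multiset) n → 0 < n → 0 < X n →
  ∃ λ h → 0 < h × h ≤ n × 0 < X h × (∀ {m} → 0 < X m → m < h → m ≡ 0)
leastPositive X = <-rec _ step
  where
  step : ∀ n → (∀ {m} → m < n → 0 < m → 0 < X m →
    ∃ λ h → 0 < h × h ≤ m × 0 < X h × (∀ {m} → 0 < X m → m < h → m ≡ 0)) → 0 < n → 0 < X n →
    ∃ λ h → 0 < h × h ≤ n × 0 < X h × (∀ {m} → 0 < X m → m < h → m ≡ 0)
  step n rec 0<n Xn with anyUpTo? (λ m → 0 <? m ×-dec 0 <? X m) n
  ... | yes (m , m<n , 0<m , Xm) with h , 0<h , h≤m , rest ← rec m<n 0<m Xm =
    h , 0<h , ≤-trans h≤m (<⇒≤ m<n) , rest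
  ... | no none = n , 0<n , ≤-refl , Xn , least
    where
    least : ∀ {m} → 0 < X m → m < n → m ≡ 0
    least {zero}  _  _   = refl
    least {suc m} Xm m<n = contradiction (suc m , m<n , z<s , Xm) none

multiples⇒scale : ∀ g .{{_ : NonZero g}} {X} → Multiples g X → X ≋ scale g (λ n → X (g * n))
multiples⇒scale g {X} mult n with g ∣? n
... | yes (divides q refl) rewrite *-comm q g = sym (scale-* g (λ n → X (g * n)) q)
... | no g∤n with X n in eq
...   | zero  = sym (scale-∤ g (λ n → X (g * n)) g∤n)
...   | suc _ = contradiction (mult (subst (0 <_) (sym eq) z<s)) g∤n

-- The value at n depends only on n / g, which gives the factorisation X(z) = Y(z^g)(1 + z + ... +
-- z^(g-1)).
block⇒act-box : ∀ g .{{_ : NonZero g}} {X} → Block g X → X ≋ act g (λ n → X (g * n)) (box g)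
block⇒act-box g {X} block n = begin
  X n                                ≡⟨ cong X (trans (m≡m%n+[m/n]*n n g) (+-comm (n % g) _)) ⟩
  X (n / g * g + n % g)              ≡⟨ block (n / g) (m%n<n n g) ⟩
  X (n / g * g)                      ≡⟨ cong X (*-comm (n / g) g) ⟩
  X (g * (n / g))                    ≡⟨ act-box-full g (λ n → X (g * n)) n ⟨
  act g (λ n → X (g * n)) (box g) n  ∎
  where open ≡-Reasoning

-- Peeling off base-g digits

module Layers (C : Multiset) (C₀ : C 0 ≡ 1) (g : ℕ) (2≤g : 2 ≤ g) where

  private instance
    g≢0 : NonZero g
    g≢0 = >-nonZero (<⇒≤ 2≤g)

  -- The members of x C divisible by g^k, divided by g^k: what remains of the summand x C after k
  -- digits are removed.
  shift : ℕ → ℕ → Multiset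
  shift k x n = scale x C (g ^ k * n)

  layer : ℕ → List ℕ → Multiset
  layer k []      = δ
  layer k (x ∷ μ) = shift k x ⊛ layer k μ

  -- The summand of the entry 1 at layer i. By `shift-power` an entry g^m at layer k repeats what
  -- the entry 1 was at layer k - m, so earlier digits can be reused.
  D : ℕ → Multiset
  D i n = C (g ^ i * n)

  D₀ : ∀ i → 0 < D i 0
  D₀ i = subst (0 <_) (sym (trans (cong C (*-zeroʳ (g ^ i))) C₀)) z<s

  layer-↭ : ∀ k {μ ν} → μ ↭ ν → layer k μ ≋ layer k ν
  layer-↭ k Perm.refl         = ≋-refl
  layer-↭ k (Perm.prep x e)   = act-congʳ 1 (shift k x) (layer-↭ k e)
  layer-↭ k (Perm.swap {xs = μ} x y e) = act-swap (shift k x) (shift k y) (layer k μ) ≤-refl ≤-refl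
    ⟨≋⟩ act-congʳ 1 (shift k y) (act-congʳ 1 (shift k x) (layer-↭ k e))
  layer-↭ k (Perm.trans e e′) = layer-↭ k e ⟨≋⟩ layer-↭ k e′

  layer-zero : ∀ {μ} → All (1 ≤_) μ → layer 0 μ ≋ R C μ
  layer-zero []                = ≋-refl
  layer-zero {x ∷ μ} (1≤x ∷ p) =
    act-cong 1 (λ n → cong (scale x C) (*-identityˡ n)) (layer-zero p)
    ⟨≋⟩ ⊛-scale x {{>-nonZero 1≤x}} C (R C μ)

  shift-* : ∀ k {x} → 1 ≤ x → ∀ {n c} → g ^ k * n ≡ x * c → shift k x n ≡ C c
  shift-* k {x} 1≤x {n} {c} e = trans (cong (scale x C) e) (scale-* x {{>-nonZero 1≤x}} C c)

  shift₀ : ∀ k {x} → 1 ≤ x → 0 < shift k x 0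
  shift₀ k {x} 1≤x = subst (0 <_) (sym (trans (shift-* k 1≤x (trans (*-zeroʳ (g ^ k)) (sym (*-zeroʳ x)))) C₀)) z<s

  layer₀ : ∀ k {μ} → All (1 ≤_) μ → 0 < layer k μ 0
  layer₀ k []        = z<s
  layer₀ k {x ∷ μ} (1≤x ∷ p) = ⊛-positive {shift k x} {layer k μ} {0} {0} (shift₀ k 1≤x) (layer₀ k p)

  layer-member : ∀ k {μ x n} → All (1 ≤_) μ → x ∈ μ → 0 < shift k x n → 0 < layer k μ n
  layer-member k {x ∷ μ} {n = n} (1≤x ∷ p) (here refl) q = subst (λ m → 0 < layer k (x ∷ μ) m) (+-identityʳ n)
    (⊛-positive {shift k x} {layer k μ} q (layer₀ k p))
  layer-member k {x ∷ μ} (1≤x ∷ p) (there y∈) q =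
    ⊛-positive {shift k x} {layer k μ} {0} (shift₀ k 1≤x) (layer-member k p y∈ q)

  layer-member⁻¹ : ∀ k {μ n} → 0 < n → 0 < layer k μ n →
    ∃₂ λ x m → x ∈ μ × 0 < m × m ≤ n × 0 < shift k x m
  layer-member⁻¹ k {[]} {suc n} _ ()
  layer-member⁻¹ k {x ∷ μ} {n} 0<n p with ⊛-positive⁻¹ {shift k x} {layer k μ} {n} p
  ... | suc a , b , refl , q , r = x , suc a , here refl , z<s , m≤m+n (suc a) b , q
  ... | zero , b , refl , q , r with y , m , y∈ , 0<m , m≤b , s ← layer-member⁻¹ k 0<n r =
    y , m , there y∈ , 0<m , m≤b , s

  shift-suc : ∀ k x n → shift (suc k) x n ≡ shift k x (g * n)
  shift-suc k x n = cong (scale x C) (trans (cong (_* n) (*-comm g (g ^ k))) (*-assoc (g ^ k) g n))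

  shift-power : ∀ {k m} → m ≤ k → shift k (g ^ m) ≋ D (k ∸ m)
  shift-power {k} {m} m≤k n = shift-* k (m^n>0 g m) (begin
    g ^ k * n                     ≡⟨ cong (λ j → g ^ j * n) (m+[n∸m]≡n m≤k) ⟨
    g ^ (m + (k ∸ m)) * n         ≡⟨ cong (_* n) (^-distribˡ-+-* g m (k ∸ m)) ⟩
    g ^ m * g ^ (k ∸ m) * n       ≡⟨ *-assoc (g ^ m) _ n ⟩
    g ^ m * (g ^ (k ∸ m) * n)     ∎)
    where open ≡-Reasoning

  layer-scale : ∀ k {σ} → (∀ {x} → x ∈ σ → Multiples g (shift k x)) →
    layer k σ ≋ scale g (layer (suc k) σ)
  layer-scale k {[]}    mult = ≋-sym (act-δ g δ)
  layer-scale k {x ∷ σ} mult =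
    act-cong 1 (multiples⇒scale g (mult (here refl)) ⟨≋⟩ act-congˡ g δ (λ n → sym (shift-suc k x n)))
               (layer-scale k (mult ∘ there))
    ⟨≋⟩ ⊛-scale g X (scale g L)
    ⟨≋⟩ (λ n → cong (λ a → act a X (scale g L) n) (sym (*-identityʳ g)))
    ⟨≋⟩ ≋-sym (act-assoc X L δ (<⇒≤ 2≤g) ≤-refl)
    where
    X = shift (suc k) x
    L = layer (suc k) σ

  -- The summand of `x` factors as X(z^g)(1 + ... + z^(g-1)) and the rest as L(z^g). Reading off the
  -- coefficient at g m leaves X L at m.
  next-layer : ∀ k {x σ} → Exact (layer k (x ∷ σ)) → Block g (shift k x) →
    (∀ {y} → y ∈ σ → Multiples g (shift k y)) → Exact (layer (suc k) (x ∷ σ))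
  next-layer k {x} {σ} exact block mult m = begin
    (X ⊛ L) m                       ≡⟨ cong (X ⊛ L) (trans (cong (_/ g) (*-comm g m)) (m*n/n≡m m g)) ⟨
    (X ⊛ L) (g * m / g)             ≡⟨ act-box-full g (X ⊛ L) (g * m) ⟨
    act g (X ⊛ L) (box g) (g * m)   ≡⟨ split (g * m) ⟩
    layer k (x ∷ σ) (g * m)         ≡⟨ exact (g * m) ⟩
    1                               ∎
    where
    open ≡-Reasoning
    X = shift (suc k) x
    L = layer (suc k) σ
    split : act g (X ⊛ L) (box g) ≋ layer k (x ∷ σ)
    split = act-assoc X L (box g) (<⇒≤ 2≤g) ≤-refl
      ⟨≋⟩ (λ n → cong (λ a → act a X (act g L (box g)) n) (*-identityʳ g))
      ⟨≋⟩ act-swap X L (box g) (<⇒≤ 2≤g) (<⇒≤ 2≤g)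
      ⟨≋⟩ ≋-sym (⊛-scale g L (act g X (box g)))
      ⟨≋⟩ ⊛-comm (scale g L) (act g X (box g))
      ⟨≋⟩ ≋-sym (act-cong 1 {shift k x}
           (block⇒act-box g {shift k x} block ⟨≋⟩ act-congˡ g (box g) (λ n → sym (shift-suc k x n)))
           (layer-scale k (λ {y} → mult {y})))

  module _ (ρ : List ℕ) (2≤ρ : All (2 ≤_) ρ) (g∈ρ : g ∈ ρ) (C₁ : 0 < C 1) where

    private
      μ : List ℕ
      μ = 1 ∷ ρ

      1≤ρ : All (1 ≤_) ρ
      1≤ρ = All.map <⇒≤ 2≤ρ

      1≤μ : All (1 ≤_) μ
      1≤μ = ≤-refl ∷ 1≤ρ

      1≤ : ∀ {x} → x ∈ μ → 1 ≤ x
      1≤ = All.lookup 1≤μ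

    -- An entry is either identified as a power of g or still divisible by g^k. `digits` keeps the
    -- behaviour of the earlier `D i`, which later describes the entries g^m.
    record Stage (k : ℕ) : Set where
      field
        exact : Exact (layer k μ)
        scales : ∀ {x} → x ∈ μ → g ^ k ∣ x ⊎ ∃ λ m → m < k × x ≡ g ^ m
        digits : ∀ {i} → i < k → Block g (D i) ⊎ Multiples g (D i)

    D-block₁ : ∀ i → Block g (D i) → 0 < D i 1
    D-block₁ i block = subst (0 <_) (sym (block 0 2≤g)) (D₀ i)

    D-multiples₁ : ∀ i → Multiples g (D i) → ¬ 0 < D i 1
    D-multiples₁ i mult p = <⇒≢ 2≤g (sym (∣1⇒≡1 (mult p)))

    -- If the summand of one entry fills whole blocks of length g, then `block⇒multiples` makes all
    -- other summands consist of multiples of g, and the whole layer can be divided by g.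
    advance : ∀ {k x σ m} → Stage k → μ ↭ x ∷ σ → Block g (shift k x) → m ≤ k → x ≡ g ^ m → Stage (suc k)
    advance {k} {x} {σ} {m} stage μ↭ block m≤k x≡ = record
      { exact  = λ n → trans (layer-↭ (suc k) μ↭ n) (next-layer k {x} exact′ block (λ {y} → mult {y}) n)
      ; scales = scales′ ∘ ∈-resp-↭ μ↭
      ; digits = λ i<1+k → [ digits , (λ { refl → digit }) ]′ (m≤n⇒m<n∨m≡n (≤-pred i<1+k))
      }
      where
      open Stage stage
      exact′ : Exact (layer k (x ∷ σ))
      exact′ n = trans (sym (layer-↭ k μ↭ n)) (exact n)
      1≤xσ : All (1 ≤_) (x ∷ σ)
      1≤xσ = All-resp-↭ μ↭ 1≤μ
      1≤σ : All (1 ≤_) σ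
      1≤σ = All.tail 1≤xσ
      mult : ∀ {y} → y ∈ σ → Multiples g (shift k y)
      mult {y} y∈ p = block⇒multiples {shift k x} {layer k σ} exact′
        (shift₀ k {x} (All.head 1≤xσ)) (layer₀ k 1≤σ) block
        (layer-member k 1≤σ y∈ p)
      scales′ : ∀ {y} → y ∈ x ∷ σ → g ^ suc k ∣ y ⊎ ∃ λ m → m < suc k × y ≡ g ^ m
      scales′ (here refl) = inj₂ (m , s≤s m≤k , x≡)
      scales′ {y} (there y∈) with scales (∈-resp-↭ (↭-sym μ↭) (there y∈))
      ... | inj₂ (m , m<k , y≡) = inj₂ (m , m<n⇒m<1+n m<k , y≡)
      -- As C 1 > 0, the cofactor q of g^k in `y` lies in `shift k y`, so g divides q.
      ... | inj₁ (divides q refl) = inj₁ (*-pres-∣ (mult y∈ (subst (0 <_) (sym (shift-* k (All.lookup 1≤σ y∈)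
              (trans (*-comm (g ^ k) q) (sym (*-identityʳ _))))) C₁)) ∣-refl)
      shift-1 : shift k 1 ≋ D k
      shift-1 = shift-power {k} {0} z≤n
      digit : Block g (D k) ⊎ Multiples g (D k)
      -- `D k` belongs to the entry 1, which is either the chosen `x` or one of the others.
      digit with ∈-resp-↭ μ↭ (here refl)
      ... | here refl = inj₁ λ q r<g → trans (sym (shift-1 _)) (trans (block q r<g) (shift-1 _))
      ... | there 1∈σ = inj₂ λ {n} p → mult 1∈σ (subst (0 <_) (sym (shift-1 n)) p)

    -- `D 0` is C itself. Because C 1 > 0 it cannot consist of multiples of g, so it contains the
    -- whole block at 0.
    small : Stage 1 → ∀ {e} → e < g → 0 < C e
    small stage {e} e<g with Stage.digits stage {0} z<s
    ... | inj₁ block = subst (0 <_) (trans (sym (block 0 e<g)) (cong C (*-identityˡ e))) (D₀ 0)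
    ... | inj₂ mult  = contradiction C₁ (D-multiples₁ 0 mult)

    -- Another entry x must supply the 1. Then x divides g^k, and `scales` gives x = g^m with 0 < m
    -- ≤ k. Its summand is `D (k ∸ m)`, whose type is already recorded; as it contains 1, it is made
    -- of blocks.
    advance-1∉ : ∀ {k} → Stage k → ¬ 0 < D k 1 → Stage (suc k)
    advance-1∉ {k} stage D₁≡0
      with x , suc zero , x∈ , _ , s≤s z≤n , p ←
        layer-member⁻¹ k {μ} {1} z<s (subst (0 <_) (sym (Stage.exact stage 1)) z<s)
      with σ , μ↭ ← ∈⇒↭ x∈ with exponent
      where
      open Stage stage
      exponent : ∃ λ m → m ≤ k × x ≡ g ^ m
      exponent with scales x∈
      ... | inj₂ (m , m<k , x≡) = m , <⇒≤ m<k , x≡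
      ... | inj₁ g^k∣x with c , e , _ ← scale-positive x {{>-nonZero (1≤ x∈)}} {C} p = k , ≤-refl ,
              ∣-antisym (divides c (trans (sym (*-identityʳ (g ^ k))) (trans e (*-comm x c)))) g^k∣x
    ... | zero , _ , refl = contradiction (subst (0 <_) (shift-power {k} {0} z≤n 1) p) D₁≡0
    ... | suc m , m<k , refl with Stage.digits stage (∸-monoʳ-< z<s m<k)
    ...   | inj₁ block = advance stage μ↭
            (λ q r<g → trans (shift-power m<k _) (trans (block q r<g) (sym (shift-power m<k _)))) m<k refl
    ...   | inj₂ mult  = contradiction (subst (0 <_) (shift-power m<k 1) p) (D-multiples₁ (k ∸ suc m) mult)

    module _ {k : ℕ} (0<k : 0 < k) (stage : Stage k) (Dk₁ : 0 < D k 1) (small : ∀ {e} → e < g → 0 < C e) where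
      open Stage stage

      private
        W : Multiset
        W = layer k ρ

        X₀ : 0 < shift k 1 0
        X₀ = shift₀ k {1} ≤-refl

        X₁ : 0 < shift k 1 1
        X₁ = subst (0 <_) (sym (shift-power {k} {0} z≤n 1)) Dk₁

        W₀ : 0 < W 0
        W₀ = layer₀ k 1≤ρ

        inW : ∀ {x n} → x ∈ ρ → 0 < shift k x n → 0 < W n
        inW = layer-member k 1≤ρ

        1∉W : ∀ {A : Set} → 0 < W 1 → A
        1∉W p = disjoint {shift k 1} {W} exact X₀ W₀ z<s X₁ p

        shift-g : 0 < shift k g g
        shift-g = subst (0 <_) (sym (shift-* k (<⇒≤ 2≤g)
          (trans (*-comm (g ^ k) g) (cong (g *_) (sym (*-identityʳ (g ^ k))))))) Dk₁

        -- The summand of the entry g already contains g, so a second entry doing so would represent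
        -- g twice.
        g-once : ∀ {y} → y ∈ ρ → g < y → ¬ 0 < shift k y g
        g-once {y} y∈ g<y p with τ , ρ↭ ← ∈⇒↭ g∈ρ with ∈-resp-↭ ρ↭ y∈
        ... | here refl = <-irrefl refl g<y
        ... | there y∈τ = disjoint {shift k g} {layer k (1 ∷ τ)}
                (λ n → trans (sym (layer-↭ k μ↭ n)) (exact n)) (shift₀ k (All.head all)) (layer₀ k (All.tail all))
                (<⇒≤ 2≤g) shift-g (layer-member k (All.tail all) (there y∈τ) p)
          where
          μ↭ : μ ↭ g ∷ 1 ∷ τ
          μ↭ = ↭-trans (Perm.prep 1 ρ↭) (Perm.swap 1 g ↭-refl)
          all : All (1 ≤_) (g ∷ 1 ∷ τ)
          all = All-resp-↭ μ↭ 1≤μ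

      -- As C 1 > 0, q itself lies in W, so minimality of h = q c gives q = h. Now g = h e with e <
      -- g, so e is in C and g lies in the summand of y = h g^k > g, against `g-once`.
      aligned : ∀ {h c} q → q * g ^ k ∈ ρ → g ^ k * h ≡ q * g ^ k * c → h ∣ g →
        0 < h → 0 < W h → (∀ {m} → 0 < W m → m < h → m ≡ 0) → ¬ h < g
      aligned {h} {c} q y∈ eq (divides e g≡) 0<h Wh least h<g =
        g-once y∈ g<y (subst (0 <_) (sym (shift-* k (All.lookup 1≤ρ y∈) g≡y*e)) (small e<g))
        where
        G = g ^ k
        instance
          G≢0 : NonZero G
          G≢0 = m^n≢0 g k
          h≢0 : NonZero h
          h≢0 = >-nonZero 0<h
        h≡q*c : h ≡ q * c
        h≡q*c = *-cancelˡ-≡ h (q * c) G (trans eq (trans (cong (_* c) (*-comm q G)) (*-assoc G q c)))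
        Wq : 0 < W q
        Wq = inW y∈ (subst (0 <_) (sym (trans (shift-* k (All.lookup 1≤ρ y∈)
               (trans (*-comm G q) (sym (*-identityʳ (q * G))))) refl)) C₁)
        q≡h : q ≡ h
        q≡h with m≤n⇒m<n∨m≡n (∣⇒≤ (divides c (trans h≡q*c (*-comm q c))))
        ... | inj₂ q≡h = q≡h
        ... | inj₁ q<h = contradiction (trans h≡q*c (cong (_* c) (least Wq q<h))) (>⇒≢ 0<h)
        2≤h : 2 ≤ h
        2≤h = ≤∧≢⇒< 0<h λ { refl → 1∉W Wh }
        0<e : 0 < e
        0<e = n≢0⇒n>0 λ { refl → contradiction g≡ (≢-nonZero⁻¹ g) }
        e<g : e < g
        e<g = subst (e <_) (sym g≡) (m<m*n e h {{>-nonZero 0<e}} 2≤h)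
        g<y : g < q * G
        -- This is where 0 < k enters: g ≤ g^k < h g^k.
        g<y = ≤-<-trans (subst (_≤ G) (^-identityʳ g) (^-monoʳ-≤ g 0<k))
                (subst (G <_) (trans (*-comm G h) (cong (_* G) (sym q≡h))) (m<m*n G h 2≤h))
        g≡y*e : G * g ≡ q * G * e
        g≡y*e = trans (cong (G *_) (trans g≡ (trans (*-comm e h) (cong (_* e) (sym q≡h)))))
                  (trans (sym (*-assoc G q e)) (cong (_* e) (*-comm G q)))

      -- By minimality h comes from a single entry of ρ. For an entry g^m with 0 < m < k, the
      -- summand `D (k ∸ m)` either contains 1, which the entry 1 already supplies, or has only
      -- multiples of g, too large for h. Multiples of g^k are left to `aligned`.
      least-step : ∀ {h} → 0 < h → 0 < W h → (∀ {m} → 0 < W m → m < h → m ≡ 0) → ¬ h < g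
      least-step {h} 0<h Wh least h<g
        with y , m , y∈ , 0<m , m≤h , s ← layer-member⁻¹ k 0<h Wh
        with m≤n⇒m<n∨m≡n m≤h
      ... | inj₁ m<h  = <-irrefl (sym (least (inW y∈ s) m<h)) 0<m
      ... | inj₂ refl with scales (there y∈)
      ...   | inj₁ (divides q refl) = aligned q y∈
              (proj₁ (proj₂ (scale-positive (q * g ^ k) {{>-nonZero (All.lookup 1≤ρ y∈)}} {C} s)))
              (least⇒multiples {shift k 1} {W} exact X₀ W₀ {{>-nonZero 0<h}} Wh least (inW g∈ρ shift-g))
              0<h Wh least h<g
      ...   | inj₂ (zero , _ , refl) = contradiction (All.lookup 2≤ρ y∈) λ { (s≤s ()) }
      ...   | inj₂ (suc m , m<k , refl) with digits (∸-monoʳ-< z<s (<⇒≤ m<k))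
      ...     | inj₁ block = 1∉W (inW y∈ (subst (0 <_) (sym (shift-power (<⇒≤ m<k) 1)) (D-block₁ (k ∸ suc m) block)))
      ...     | inj₂ mult  = >⇒∤ {{>-nonZero 0<h}} h<g (mult (subst (0 <_) (shift-power (<⇒≤ m<k) h) s))

      -- g lies in W because g^k lies in C. Hence the least positive member of W is at most g, and
      -- `least-step` makes it g, so the entry 1 fills blocks of length g.
      advance-1∈ : Stage (suc k)
      advance-1∈ with h , 0<h , h≤g , Wh , least ← leastPositive W g (<⇒≤ 2≤g) (inW g∈ρ shift-g)
        with m≤n⇒m<n∨m≡n h≤g
      ... | inj₁ h<g  = contradiction h<g (least-step 0<h Wh least)
      ... | inj₂ refl = advance stage ↭-refl (least⇒block {shift k 1} {W} exact X₀ W₀ Wh least) z≤n refl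

    module _ (exact : Exact (R C μ)) (g-least : All (g ≤_) ρ) where

      stage₀ : Stage 0
      stage₀ = record
        { exact  = λ n → trans (layer-zero 1≤μ n) (exact n)
        ; scales = λ {x} _ → inj₁ (1∣ x)
        ; digits = λ ()
        }

      -- Every member of x C is a multiple of x ≥ g, so g is the least positive member of the sum
      -- over ρ.
      stage₁ : Stage 1
      stage₁ = advance stage₀ ↭-refl (least⇒block {shift 0 1} {layer 0 ρ} (Stage.exact stage₀)
          (shift₀ 0 {1} ≤-refl) (layer₀ 0 1≤ρ) Wg least) z≤n refl
        where
        Wg : 0 < layer 0 ρ g
        Wg = layer-member 0 1≤ρ g∈ρ (subst (0 <_) (sym (shift-* 0 (<⇒≤ 2≤g) (*-comm 1 g))) C₁)
        least : ∀ {m} → 0 < layer 0 ρ m → m < g → m ≡ 0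
        least {zero}  _ _ = refl
        least {suc m} Wm m<g with x , m′ , x∈ , 0<m′ , m′≤m , s ← layer-member⁻¹ 0 {ρ} {suc m} z<s Wm
          with c , eq , _ ← scale-positive x {{>-nonZero (All.lookup 1≤ρ x∈)}} {C} s =
          contradiction (≤-trans (All.lookup g-least x∈) (≤-trans
            (∣⇒≤ {{>-nonZero 0<m′}} (divides c (trans (sym (*-identityˡ m′)) (trans eq (*-comm x c))))) m′≤m)) (<⇒≱ m<g)

      stages : ∀ k → Stage (suc k)
      stages zero = stage₁
      -- The test asks whether g^(k+1) is in C, which decides whether the entry 1 or another one
      -- carries this digit.
      stages (suc k) with 0 <? D (suc k) 1
      ... | yes D₁ = advance-1∈ z<s (stages k) D₁ (small stage₁)
      ... | no  D₁ = advance-1∉ (stages k) D₁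

      powers : ∀ {x} → x ∈ μ → ∃ λ m → x ≡ g ^ m
      powers {x} x∈ with Stage.scales (stages x) x∈
      ... | inj₂ (m , _ , x≡) = m , x≡
      -- Layer x + 1 is far enough, since g^(x+1) exceeds x and cannot divide it.
      ... | inj₁ g^∣x = contradiction (∣⇒≤ {{>-nonZero (1≤ x∈)}} g^∣x)
              (<⇒≱ (<-trans (n<1+n x) (n<g^n 2≤g (suc x))))

-- All entries are powers of one integer

minimum : ∀ y ys → ∃ λ g → g ∈ y ∷ ys × All (g ≤_) (y ∷ ys)
minimum y [] = y , here refl , ≤-refl ∷ []
minimum y (z ∷ zs) with g , g∈ , g≤ ← minimum z zs with ≤-total y g
... | inj₁ y≤g = y , here refl , ≤-refl ∷ All.map (≤-trans y≤g) g≤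
... | inj₂ g≤y = g , there g∈ , g≤y ∷ g≤

exact⇒powers : ∀ {C μ} → All (1 ≤_) μ → Exact (R C μ) → ∃ λ g → ∀ {x} → x ∈ μ → ∃ λ m → x ≡ g ^ m
exact⇒powers {C} {μ} p exact with ones≡1 p (exact-ones p exact)
... | []    , μ↭ , _ = 1 , λ x∈ → 0 , ∈-[1] (∈-resp-↭ μ↭ x∈)
  where
  ∈-[1] : ∀ {x} → x ∈ 1 ∷ [] → x ≡ 1
  ∈-[1] (here refl) = refl
... | y ∷ ys , μ↭ , q with g , g∈ , g≤ ← minimum y ys =
  g , λ x∈ → Layers.powers C (R-zero⁻¹ C {μ} exact) g (All.lookup q g∈) (y ∷ ys) q g∈
    (subst (0 <_) (sym (exact-one p exact)) z<s)
    (λ n → trans (sym (R-↭ C p μ↭ n)) (exact n)) g≤ (∈-resp-↭ μ↭ x∈)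

-- Sorted vectors

sorted-↭⇒≡ : ∀ {xs ys} → Sorted ≤-totalOrder xs → Sorted ≤-totalOrder ys → xs ↭ ys → xs ≡ ys
sorted-↭⇒≡ p q e = ≋⇒≡ (↗↭↗⇒≋ ≤-totalOrder p q (↭⇒↭ₛ e))

kron-↭ : ∀ α β → kron α β ↭ α ⊗ β
kron-↭ α β = sort-↭ (α ⊗ β)

kron-↗ : ∀ α β → Sorted ≤-totalOrder (kron α β)
kron-↗ α β = sort-↗ (α ⊗ β)

kron-≡ : ∀ α β γ δ → α ⊗ β ↭ γ ⊗ δ → kron α β ≡ kron γ δ
kron-≡ α β γ δ e = sorted-↭⇒≡ (kron-↗ α β) (kron-↗ γ δ) (↭-trans (kron-↭ α β) (↭-trans e (↭-sym (kron-↭ γ δ))))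

-- The product of multisets

map-* : ∀ a b γ → map (a *_) (map (b *_) γ) ≡ map (a * b *_) γ
map-* a b γ = trans (sym (map-∘ γ)) (map-cong (λ c → sym (*-assoc a b c)) γ)

++-⊗ : ∀ α β γ → (α ++ β) ⊗ γ ≡ α ⊗ γ ++ β ⊗ γ
++-⊗ []      β γ = refl
++-⊗ (a ∷ α) β γ = trans (cong (map (a *_) γ ++_) (++-⊗ α β γ)) (sym (++-assoc (map (a *_) γ) _ _))

map-⊗ : ∀ a β γ → map (a *_) β ⊗ γ ≡ map (a *_) (β ⊗ γ)
map-⊗ a []      γ = refl
map-⊗ a (b ∷ β) γ = trans (cong₂ _++_ (sym (map-* a b γ)) (map-⊗ a β γ)) (sym (map-++ (a *_) (map (b *_) γ) _))

⊗-assoc : ∀ α β γ → (α ⊗ β) ⊗ γ ≡ α ⊗ (β ⊗ γ)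
⊗-assoc []      β γ = refl
⊗-assoc (a ∷ α) β γ = trans (++-⊗ (map (a *_) β) (α ⊗ β) γ) (cong₂ _++_ (map-⊗ a β γ) (⊗-assoc α β γ))

⊗-identityˡ : ∀ α → (1 ∷ []) ⊗ α ≡ α
⊗-identityˡ α = trans (++-identityʳ _) (trans (map-cong *-identityˡ α) (map-id α))

⊗-zeroʳ : ∀ α → α ⊗ [] ≡ []
⊗-zeroʳ []      = refl
⊗-zeroʳ (a ∷ α) = ⊗-zeroʳ α

⊗-∷ʳ : ∀ α b β → α ⊗ (b ∷ β) ↭ map (b *_) α ++ α ⊗ β
⊗-∷ʳ []      b β = ↭-refl
⊗-∷ʳ (a ∷ α) b β rewrite *-comm a b = Perm.prep (b * a) (↭-trans (Perm.++⁺ˡ (map (a *_) β) (⊗-∷ʳ α b β))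
  (Perm.shifts (map (a *_) β) (map (b *_) α)))

⊗-comm : ∀ α β → α ⊗ β ↭ β ⊗ α
⊗-comm []      β = ↭-reflexive (sym (⊗-zeroʳ β))
⊗-comm (a ∷ α) β = ↭-trans (Perm.++⁺ˡ (map (a *_) β) (⊗-comm α β)) (↭-sym (⊗-∷ʳ β a α))

⊗-congʳ : ∀ α {β γ} → β ↭ γ → α ⊗ β ↭ α ⊗ γ
⊗-congʳ []      e = ↭-refl
⊗-congʳ (a ∷ α) e = Perm.++⁺ (Perm.map⁺ (a *_) e) (⊗-congʳ α e)

⊗-cong : ∀ {α β γ δ} → α ↭ β → γ ↭ δ → α ⊗ γ ↭ β ⊗ δ
⊗-cong {α} {β} {γ} {δ} e e′ = ↭-trans (⊗-congʳ α e′) (↭-trans (⊗-comm α δ)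
  (↭-trans (⊗-congʳ δ e) (⊗-comm δ β)))

⊗-commutativeSemigroup : CommutativeSemigroup 0ℓ 0ℓ
⊗-commutativeSemigroup = record
  { Carrier = List ℕ
  ; _≈_     = _↭_
  ; _∙_     = _⊗_
  ; isCommutativeSemigroup = record
    { isSemigroup = record
      { isMagma = record { isEquivalence = Perm.↭-isEquivalence ; ∙-cong = ⊗-cong }
      ; assoc   = λ α β γ → ↭-reflexive (⊗-assoc α β γ)
      }
    ; comm = ⊗-comm
    }
  }

open Algebra.Properties.CommutativeSemigroup ⊗-commutativeSemigroup using (interchange; xy∙z≈xz∙y)

∈-⊗⁺ : ∀ {α β a b} → a ∈ α → b ∈ β → a * b ∈ α ⊗ β
∈-⊗⁺ {a ∷ α} {β} (here refl) b∈ = ∈-++⁺ˡ (∈-map⁺ (a *_) b∈)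
∈-⊗⁺ {a ∷ α} {β} (there a∈)  b∈ = ∈-++⁺ʳ (map (a *_) β) (∈-⊗⁺ a∈ b∈)

∈-⊗⁻ : ∀ α β {c} → c ∈ α ⊗ β → ∃₂ λ a b → a ∈ α × b ∈ β × c ≡ a * b
∈-⊗⁻ (a ∷ α) β c∈ with ∈-++⁻ (map (a *_) β) c∈
... | inj₁ c∈ with b , b∈ , c≡ ← ∈-map⁻ (a *_) c∈ = a , b , here refl , b∈ , c≡
... | inj₂ c∈ with a , b , a∈ , b∈ , c≡ ← ∈-⊗⁻ α β c∈ = a , b , there a∈ , b∈ , c≡

⊗-positive : ∀ {α β} → All (1 ≤_) α → All (1 ≤_) β → All (1 ≤_) (α ⊗ β)
⊗-positive {α} {β} p q = All.tabulate positive
  where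
  positive : ∀ {c} → c ∈ α ⊗ β → 1 ≤ c
  positive c∈ with a , b , a∈ , b∈ , refl ← ∈-⊗⁻ α β c∈ = *-mono-≤ (All.lookup p a∈) (All.lookup q b∈)

kron-positive : ∀ {α β} → All (1 ≤_) α → All (1 ≤_) β → All (1 ≤_) (kron α β)
kron-positive {α} {β} p q = All-resp-↭ (↭-sym (kron-↭ α β)) (⊗-positive p q)

-- Geometric progressions

geom-suc : ∀ l e k → geom l e (suc k) ≡ 1 ∷ map (l ^ e *_) (geom l e k)
geom-suc l e k = cong (1 ∷_) (begin
  map f (applyUpTo suc k)        ≡⟨ map-applyUpTo suc f k ⟩
  applyUpTo (f ∘ suc) k          ≡⟨ map-upTo (f ∘ suc) k ⟨
  map (f ∘ suc) (upTo k)         ≡⟨ map-cong (λ i → ^-distribˡ-+-* l e (i * e)) (upTo k) ⟩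
  map (λ i → l ^ e * f i) (upTo k) ≡⟨ map-∘ (upTo k) ⟩
  map (l ^ e *_) (geom l e k)    ∎)
  where
  open ≡-Reasoning
  f = λ i → l ^ (i * e)

geom-+ : ∀ l e m n → geom l e (m + n) ≡ geom l e m ++ map (l ^ (m * e) *_) (geom l e n)
geom-+ l e zero    n = sym (trans (map-cong *-identityˡ _) (map-id _))
geom-+ l e (suc m) n = begin
  geom l e (suc m + n)                                 ≡⟨ geom-suc l e (m + n) ⟩
  1 ∷ map (l ^ e *_) (geom l e (m + n))                ≡⟨ cong (λ k → 1 ∷ map (l ^ e *_) k) (geom-+ l e m n) ⟩
  1 ∷ map (l ^ e *_) (geom l e m ++ map (l ^ (m * e) *_) (geom l e n))
    ≡⟨ cong (1 ∷_) (map-++ (l ^ e *_) (geom l e m) _) ⟩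
  1 ∷ map (l ^ e *_) (geom l e m) ++ map (l ^ e *_) (map (l ^ (m * e) *_) (geom l e n))
    ≡⟨ cong₂ _++_ (sym (geom-suc l e m)) (trans (map-* (l ^ e) (l ^ (m * e)) (geom l e n))
         (cong (λ c → map (c *_) (geom l e n)) (sym (^-distribˡ-+-* l e (m * e))))) ⟩
  geom l e (suc m) ++ map (l ^ (suc m * e) *_) (geom l e n) ∎
  where open ≡-Reasoning

-- Every exponent below v u is i + u j for exactly one i < u and j < v. In this order of the factors
-- the blocks simply concatenate, giving equality rather than a permutation.
geom-⊗ : ∀ l e u v → geom l (e * u) v ⊗ geom l e u ≡ geom l e (v * u)
geom-⊗ l e u zero    = refl
geom-⊗ l e u (suc v) = begin
  geom l (e * u) (suc v) ⊗ geom l e u               ≡⟨ cong (_⊗ geom l e u) (geom-suc l (e * u) v) ⟩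
  map (1 *_) (geom l e u) ++ map (l ^ (e * u) *_) (geom l (e * u) v) ⊗ geom l e u
    ≡⟨ cong₂ _++_ (trans (map-cong *-identityˡ _) (map-id _))
         (trans (map-⊗ (l ^ (e * u)) (geom l (e * u) v) (geom l e u))
           (cong₂ (λ c → map (l ^ c *_)) (*-comm e u) (geom-⊗ l e u v))) ⟩
  geom l e u ++ map (l ^ (u * e) *_) (geom l e (v * u)) ≡⟨ geom-+ l e u (v * u) ⟨
  geom l e (suc v * u)                              ∎
  where open ≡-Reasoning

geom-⊗′ : ∀ l e u v → geom l e u ⊗ geom l (e * u) v ↭ geom l e (u * v)
geom-⊗′ l e u v = ↭-trans (⊗-comm (geom l e u) _)
  (↭-reflexive (trans (geom-⊗ l e u v) (cong (geom l e) (*-comm v u))))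

geom-^ : ∀ g a e k → geom (g ^ a) e k ≡ geom g (a * e) k
geom-^ g a e k = map-cong (λ i → trans (^-*-assoc g a (i * e)) (cong (g ^_)
  (trans (sym (*-assoc a i e)) (trans (cong (_* e) (*-comm a i)) (*-assoc i a e))))) (upTo k)

∈-geom⁻ : ∀ l e k {x} → x ∈ geom l e k → ∃ λ i → x ≡ l ^ i
∈-geom⁻ l e k x∈ with i , _ , x≡ ← ∈-map⁻ (λ i → l ^ (i * e)) x∈ = i * e , x≡

geom-positive : ∀ l .{{_ : NonZero l}} e k → All (1 ≤_) (geom l e k)
geom-positive l e k = All.map⁺ (All.universal (λ i → m^n>0 l (i * e)) (upTo k))

-- Mixed radix notation. At each level the two progressions join into one of length u v and step P,
-- and the remaining levels continue with step P u v.
lamU⊗lamV : ∀ P l {r} (u v : Vec ℕ r) → lamU' P l u v ⊗ lamV' P l u v ↭ geom l P (prodUV u v)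
lamU⊗lamV P l []      []      = ↭-refl
lamU⊗lamV P l (u ∷ us) (v ∷ vs) = begin
  kron G U ⊗ kron H V          ↭⟨ ⊗-cong (kron-↭ G U) (kron-↭ H V) ⟩
  (G ⊗ U) ⊗ (H ⊗ V)            ↭⟨ interchange G U H V ⟩
  (G ⊗ H) ⊗ (U ⊗ V)            ↭⟨ ⊗-cong (geom-⊗′ l P u v) (lamU⊗lamV (P * u * v) l us vs) ⟩
  geom l P (u * v) ⊗ geom l (P * u * v) n ≡⟨ cong (λ e → geom l P (u * v) ⊗ geom l e n) (*-assoc P u v) ⟩
  geom l P (u * v) ⊗ geom l (P * (u * v)) n ↭⟨ geom-⊗′ l P (u * v) n ⟩
  geom l P (u * v * n)         ∎
  where
  open Perm.PermutationReasoning
  G = geom l P u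
  H = geom l (P * u) v
  U = lamU' (P * u * v) l us vs
  V = lamV' (P * u * v) l us vs
  n = prodUV us vs

module _ (l : ℕ) .{{_ : NonZero l}} where

  lamU-positive : ∀ P {r} (u v : Vec ℕ r) → All (1 ≤_) (lamU' P l u v)
  lamU-positive P []       []       = ≤-refl ∷ []
  lamU-positive P (u ∷ us) (v ∷ vs) = kron-positive (geom-positive l P u) (lamU-positive (P * u * v) us vs)

  lamV-positive : ∀ P {r} (u v : Vec ℕ r) → All (1 ≤_) (lamV' P l u v)
  lamV-positive P []       []       = ≤-refl ∷ []
  lamV-positive P (u ∷ us) (v ∷ vs) = kron-positive (geom-positive l (P * u) v) (lamV-positive (P * u * v) us vs)

lamV-powers : ∀ P l {r} (u v : Vec ℕ r) {x} → x ∈ lamV' P l u v → ∃ λ i → x ≡ l ^ i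
lamV-powers P l []       []       (here refl) = 0 , refl
lamV-powers P l (u ∷ us) (v ∷ vs) x∈
  with a , b , a∈ , b∈ , refl ←
    ∈-⊗⁻ (geom l (P * u) v) (lamV' (P * u * v) l us vs) (∈-resp-↭ (kron-↭ (geom l (P * u) v) _) x∈)
  with i , refl ← ∈-geom⁻ l (P * u) v a∈ | j , refl ← lamV-powers (P * u * v) l us vs b∈ =
  i + j , sym (^-distribˡ-+-* l i j)

lamV-↗ : ∀ P l {r} (u v : Vec ℕ r) → Sorted ≤-totalOrder (lamV' P l u v)
lamV-↗ P l []       []       = [-]
lamV-↗ P l (u ∷ us) (v ∷ vs) = kron-↗ (geom l (P * u) v) _

-- Powers

^-distribʳ-* : ∀ n a b → (a * b) ^ n ≡ a ^ n * b ^ n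
^-distribʳ-* zero    a b = refl
^-distribʳ-* (suc n) a b = trans (cong (a * b *_) (^-distribʳ-* n a b)) ([m*n]*[o*p]≡[m*o]*[n*p] a b (a ^ n) (b ^ n))

coprime-* : ∀ {a b c} → Coprime a b → Coprime a c → Coprime a (b * c)
coprime-* a⊥b a⊥c (d∣a , d∣bc) =
  a⊥c (d∣a , coprime-divisor (λ { (e∣d , e∣b) → a⊥b (∣-trans e∣d d∣a , e∣b) }) d∣bc)

coprime-^ : ∀ {a b} n → Coprime a b → Coprime a (b ^ n)
coprime-^ zero    _   = Coprime.sym (Coprime.1-coprimeTo _)
coprime-^ (suc n) a⊥b = coprime-* a⊥b (coprime-^ n a⊥b)

-- After division by the gcd the two q-th powers are coprime while the first divides the second, so
-- the first is 1 and x equals the gcd.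
^-∣⇒∣ : ∀ {x y} q .{{_ : NonZero x}} .{{_ : NonZero q}} → x ^ q ∣ y ^ q → x ∣ y
^-∣⇒∣ {x} {y} q x^q∣y^q = subst (_∣ y) (sym x≡d) (gcd[m,n]∣n x y)
  where
  d = gcd x y
  instance
    d≢0 : NonZero d
    d≢0 = ≢-nonZero (≢-nonZero⁻¹ x ∘ gcd[m,n]≡0⇒m≡0)
    d^q≢0 : NonZero (d ^ q)
    d^q≢0 = m^n≢0 d q
  x≡ : x / d * d ≡ x
  x≡ = m/n*n≡m (gcd[m,n]∣m x y)
  y≡ : y / d * d ≡ y
  y≡ = m/n*n≡m (gcd[m,n]∣n x y)
  reduced : (x / d) ^ q ∣ (y / d) ^ q
  reduced = *-cancelʳ-∣ (d ^ q) (subst₂ _∣_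
    (trans (cong (_^ q) (sym x≡)) (^-distribʳ-* q (x / d) d))
    (trans (cong (_^ q) (sym y≡)) (^-distribʳ-* q (y / d) d)) x^q∣y^q)
  coprime : Coprime ((x / d) ^ q) ((y / d) ^ q)
  coprime = Coprime.sym (coprime-^ q (Coprime.sym (coprime-^ q (coprime-/gcd x y))))
  x≡d : x ≡ d
  x≡d with m^n≡1⇒n≡0∨m≡1 (x / d) q (coprime (∣-refl , reduced))
  ... | inj₁ q≡0   = contradiction q≡0 (≢-nonZero⁻¹ q)
  ... | inj₂ x/d≡1 = trans (sym x≡) (trans (cong (_* d) x/d≡1) (*-identityˡ d))

-- A common base for dependent integers

CommonBase : ℕ → ℕ → Set
CommonBase l l′ = ∃ λ g → ∃₂ λ a b → l ≡ g ^ a × l′ ≡ g ^ b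

private
  -- The bound on l + l′ is the measure for the descent.
  Base : ℕ → Set
  Base n = ∀ {l l′ p q} → l + l′ ≤ n → 2 ≤ l → 2 ≤ l′ → 0 < p → 0 < q → l ^ p ≡ l′ ^ q → CommonBase l l′

-- Euclid's algorithm: l^q divides l′^q, so l′ = m l and l^(p-q) = m^q.
descend : ∀ {n} → Base n → ∀ {l l′ p q} → l + l′ ≤ suc n → 2 ≤ l → 2 ≤ l′ → 0 < p → 0 < q →
  l ^ p ≡ l′ ^ q → l ≤ l′ → CommonBase l l′
descend rec {l} {l′} {p} {q} l+l′≤n 2≤l 2≤l′ 0<p 0<q e l≤l′ = go l∣l′
  where
  instance
    _ = >-nonZero (<⇒≤ 2≤l)
    _ = >-nonZero 0<q
    _ = m^n≢0 l q
  q≤p : q ≤ p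
  q≤p = ≮⇒≥ λ p<q → <-irrefl e (<-≤-trans (^-monoʳ-< l 2≤l p<q) (^-monoˡ-≤ q l≤l′))
  split : l ^ p ≡ l ^ (p ∸ q) * l ^ q
  split = trans (cong (l ^_) (sym (m∸n+n≡m q≤p))) (^-distribˡ-+-* l (p ∸ q) q)
  l∣l′ : l ∣ l′
  l∣l′ = ^-∣⇒∣ q (divides (l ^ (p ∸ q)) (trans (sym e) split))
  go : l ∣ l′ → CommonBase l l′
  go (divides zero refl) = contradiction 2≤l′ λ ()
  go (divides 1 refl) = l , 1 , 1 , sym (^-identityʳ l) , *-comm 1 l
  go (divides m@(suc (suc _)) refl) = extend (rec {l} {m} {p ∸ q} {q}
      (≤-pred (≤-trans (+-monoʳ-< l (m<m*n m l 2≤l)) l+l′≤n)) 2≤l (s≤s (s≤s z≤n)) 0<p∸q 0<q reduced)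
    where
    extend : CommonBase l m → CommonBase l (m * l)
    extend (g , a , b , l≡ , m≡) = g , a , b + a , l≡ , trans (cong₂ _*_ m≡ l≡) (sym (^-distribˡ-+-* g b a))
    reduced : l ^ (p ∸ q) ≡ m ^ q
    reduced = *-cancelʳ-≡ _ _ (l ^ q) (trans (sym split) (trans e (^-distribʳ-* q m l)))
    0<p∸q : 0 < p ∸ q
    0<p∸q = n≢0⇒n>0 λ p∸q≡0 → [ >⇒≢ 0<q , (λ ()) ]′ (m^n≡1⇒n≡0∨m≡1 m q (trans (sym reduced) (cong (l ^_) p∸q≡0)))

common-base : ∀ n → Base n
common-base zero {l} l+l′≤0 2≤l = contradiction (≤-trans 2≤l (m+n≤o⇒m≤o l l+l′≤0)) λ ()
common-base (suc n) {l} {l′} l+l′≤n 2≤l 2≤l′ 0<p 0<q e with ≤-total l l′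
... | inj₁ l≤l′ = descend (common-base n) l+l′≤n 2≤l 2≤l′ 0<p 0<q e l≤l′
... | inj₂ l′≤l with g , a , b , l′≡ , l≡ ←
  descend (common-base n) (subst (_≤ suc n) (+-comm l l′) l+l′≤n) 2≤l′ 2≤l 0<q 0<p (sym e) l′≤l
  = g , b , a , l≡ , l′≡

-- C is the set S^(g,L) of the paper.
module DigitSet (g L : ℕ) (2≤g : 2 ≤ g) (1≤L : 1 ≤ L) where

  private
    K : ℕ
    K = g ^ L

    1≤g : 1 ≤ g
    1≤g = <⇒≤ 2≤g

    instance
      g≢0 : NonZero g
      g≢0 = >-nonZero 1≤g
      K≢0 : NonZero K
      K≢0 = m^n≢0 g L

    2≤K : 2 ≤ K
    2≤K = ≤-trans 2≤g (subst (_≤ K) (^-identityʳ g) (^-monoʳ-≤ g 1≤L))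

    n/<n : ∀ {d} .{{_ : NonZero d}} n → 2 ≤ d → suc n / d ≤ n
    n/<n {d} n 2≤d = ≤-pred (m/n<m (suc n) d 2≤d)

    -- Membership means that all base-K digits are below g. The first argument is fuel, and any
    -- value of at least n gives the same answer, because n / K < n for n > 0.
    approx : ℕ → Multiset
    approx zero    n = 1
    approx (suc f) n = if n % K <ᵇ g then approx f (n / K) else 0

    approx₀ : ∀ f → approx f 0 ≡ 1
    approx₀ zero    = refl
    approx₀ (suc f) = trans (cong₂ (λ r q → if r <ᵇ g then approx f q else 0)
        (m<n⇒m%n≡m {n = K} (<⇒≤ 2≤K)) (0/n≡0 K)) (trans (if-< 1≤g) (approx₀ f))

    approx-stable : ∀ f f′ n → n ≤ f → n ≤ f′ → approx f n ≡ approx f′ n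
    approx-stable f f′ zero _ _ = trans (approx₀ f) (sym (approx₀ f′))
    approx-stable (suc f) (suc f′) (suc n) (s≤s n≤f) (s≤s n≤f′) = cong (λ k → if suc n % K <ᵇ g then k else 0)
      (approx-stable f f′ (suc n / K) (≤-trans (n/<n n 2≤K) n≤f) (≤-trans (n/<n n 2≤K) n≤f′))

  C : Multiset
  C n = approx n n

  C₀ : C 0 ≡ 1
  C₀ = refl

  private
    g≤K : g ≤ K
    g≤K = subst (_≤ K) (^-identityʳ g) (^-monoʳ-≤ g 1≤L)

    C-digits : C ≋ act K C (box g)
    C-digits n = trans (go n) (sym (act-box K C g≤K n))
      where
      go : ∀ n → C n ≡ (if n % K <ᵇ g then C (n / K) else 0)
      go n = trans (approx-stable n (suc n) n ≤-refl (n≤1+n n))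
        (cong (λ k → if n % K <ᵇ g then k else 0) (approx-stable n (n / K) (n / K) (m/n≤m n K) ≤-refl))

    P : Multiset
    P = R C (geom g 1 L)

    ^1 : g ^ 1 ≡ g
    ^1 = ^-identityʳ g

    positive : ∀ k → All (1 ≤_) (geom g 1 k)
    positive = geom-positive g 1

    -- Raising every exponent by one drops 1 and adds K, so P(z^g) C(z) = C(z^K) P(z).
    rotate : map (g *_) (geom g 1 L) ++ 1 ∷ [] ↭ K ∷ geom g 1 L
    rotate = begin
      map (g *_) (geom g 1 L) ++ 1 ∷ []      ↭⟨ Perm.∷↭∷ʳ 1 _ ⟨
      1 ∷ map (g *_) (geom g 1 L)            ≡⟨ cong (λ c → 1 ∷ map (c *_) (geom g 1 L)) ^1 ⟨
      1 ∷ map (g ^ 1 *_) (geom g 1 L)        ≡⟨ geom-suc g 1 L ⟨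
      geom g 1 (suc L)                       ≡⟨ cong (geom g 1) (+-comm L 1) ⟨
      geom g 1 (L + 1)                       ≡⟨ geom-+ g 1 L 1 ⟩
      geom g 1 L ++ g ^ (L * 1) * 1 ∷ []     ≡⟨ cong (λ c → geom g 1 L ++ c ∷ [])
                                                  (trans (*-identityʳ _) (cong (g ^_) (*-identityʳ L))) ⟩
      geom g 1 L ++ K ∷ []                   ↭⟨ Perm.∷↭∷ʳ K _ ⟨
      K ∷ geom g 1 L                         ∎
      where open Perm.PermutationReasoning

    1≤rotated : All (1 ≤_) (map (g *_) (geom g 1 L) ++ 1 ∷ [])
    1≤rotated = All-resp-↭ (↭-sym rotate) (m^n>0 g L ∷ positive L)

    shifted : act K C P ≋ act K C (act g P (box g))
    shifted = ≋-sym (R-↭ C 1≤rotated rotate)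
      ⟨≋⟩ R-map-++ C (1 ∷ []) 1≤g (positive L)
      ⟨≋⟩ act-congʳ g P (scale-1 C)
      ⟨≋⟩ act-congʳ g P C-digits
      ⟨≋⟩ act-swap P C (box g) 1≤g (m^n>0 g L)

    scaleC₀ : scale K C 0 ≡ 1
    scaleC₀ = trans (cong (scale K C) (sym (*-zeroʳ K))) (scale-* K C 0)

    -- Substituting C(z) = C(z^K)(1 + ... + z^(g-1)) into the rotation identity and cancelling
    -- C(z^K) leaves P(z) = P(z^g)(1 + ... + z^(g-1)).
    P-digits : ∀ n → P n ≡ P (n / g)
    P-digits n = trans (⊛-cancel {P} {act g P (box g)} {scale K C} {scale K C} scaleC₀ scaleC₀ (λ _ _ _ _ → refl)
        (⊛-comm P (scale K C) ⟨≋⟩ ⊛-scale K C P ⟨≋⟩ shifted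
         ⟨≋⟩ ≋-sym (⊛-scale K C (act g P (box g))) ⟨≋⟩ ⊛-comm (scale K C) (act g P (box g))) n)
      (act-box-full g P n)

  exact : Exact P
  exact = <-rec _ step
    where
    step : ∀ n → (∀ {m} → m < n → P m ≡ 1) → P n ≡ 1
    step zero    ih = R-zero C {geom g 1 L} C₀
    step (suc n) ih = trans (P-digits (suc n)) (ih (s≤s (n/<n n 2≤g)))

-- Splitting off the single entry 1 of α turns exactness into A ⊛ R A ρ = 1 with ρ ≥ 2. The second
-- factor up to n depends only on A below n, so the values of A are determined one after another.
dil-injective : ∀ {α A A′} → All (1 ≤_) α → Exact (R A α) → Exact (R A′ α) → A ≋ A′
dil-injective {α} {A} {A′} p e e′ with ρ , α↭ , q ← ones≡1 p (exact-ones p e) =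
  ⊛-cancel {A} {A′} {R A ρ} {R A′ ρ} (R-zero A {ρ} (R-zero⁻¹ A {α} e)) (R-zero A′ {ρ} (R-zero⁻¹ A′ {α} e′))
    (λ n 0<n ag → R-agree n 0<n ag q)
    (λ n → trans (trans (sym (R-↭ A p α↭ n)) (e n)) (sym (trans (sym (R-↭ A′ p α↭ n)) (e′ n))))

-- Counting entries equal to 1

ones-++ : ∀ α β → ones (α ++ β) ≡ ones α + ones β
ones-++ []                  β = refl
ones-++ (zero ∷ α)          β = ones-++ α β
ones-++ (suc zero ∷ α)      β = cong suc (ones-++ α β)
ones-++ (suc (suc _) ∷ α)   β = ones-++ α β

≥2⇒ones≡0 : ∀ {α} → All (2 ≤_) α → ones α ≡ 0
≥2⇒ones≡0 []                        = refl
≥2⇒ones≡0 (s≤s (s≤s z≤n) ∷ p)       = ≥2⇒ones≡0 p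

-- A product of positive integers is 1 only if both factors are.
ones-⊗ : ∀ {α β} → All (1 ≤_) α → All (1 ≤_) β → ones (α ⊗ β) ≡ ones α * ones β
ones-⊗ []      q = refl
ones-⊗ {suc zero ∷ α} {β} (_ ∷ p) q = trans (ones-++ (map (1 *_) β) (α ⊗ β))
  (cong₂ _+_ (cong ones (trans (map-cong *-identityˡ β) (map-id β))) (ones-⊗ p q))
ones-⊗ {a@(suc (suc _)) ∷ α} {β} (_ ∷ p) q = trans (ones-++ (map (a *_) β) (α ⊗ β))
  (cong₂ _+_ (≥2⇒ones≡0 {map (a *_) β} (All.map⁺ (All.map (λ 1≤b → *-mono-≤ {2} {a} {1} (s≤s (s≤s z≤n)) 1≤b) q)))
             (ones-⊗ p q))

exact-nonempty : ∀ {A α} → Exact (R A α) → 1 ≤ length α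
exact-nonempty {α = []}    e = contradiction (e 1) λ ()
exact-nonempty {α = _ ∷ _} e = s≤s z≤n

nontrivial-element : ∀ {A α} → All (1 ≤_) α → Exact (R A α) → α ≢ 1 ∷ [] → ∃ λ w → w ∈ α × 2 ≤ w
nontrivial-element p e α≢1 with ones≡1 p (exact-ones p e)
... | []    , α↭ , _       = contradiction (Perm.↭-singleton-inv α↭) α≢1
... | w ∷ ρ , α↭ , 2≤w ∷ _ = w , ∈-resp-↭ (↭-sym α↭) (there (here refl)) , 2≤w

ones≡1⇒1∈ : ∀ {α} → All (1 ≤_) α → ones α ≡ 1 → 1 ∈ α
ones≡1⇒1∈ p e with ρ , α↭ , _ ← ones≡1 p e = ∈-resp-↭ (↭-sym α↭) (here refl)

all-ones : ∀ {α} → ones α ≡ 1 → (∀ {x} → x ∈ α → x ≡ 1) → α ≡ 1 ∷ []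
all-ones {α} e all = lemma α e (All.tabulate all)
  where
  none : ∀ α → ones α ≡ 0 → All (_≡ 1) α → α ≡ []
  none []        _  _          = refl
  none (.1 ∷ α) () (refl ∷ _)
  lemma : ∀ α → ones α ≡ 1 → All (_≡ 1) α → α ≡ 1 ∷ []
  lemma (.1 ∷ α) e (refl ∷ p) = cong (1 ∷_) (none α (suc-injective e) p)

CardAtLeast2-R : ∀ {C α} → All (1 ≤_) α → Exact (R C α) → CardAtLeast2 C
CardAtLeast2-R p e = 1 , z<s , subst (0 <_) (sym (exact-one p e)) z<s

kron-identityˡ : ∀ {α} → IsZm α → kron (1 ∷ []) α ≡ α
kron-identityˡ {α} (α↗ , _) = sorted-↭⇒≡ (kron-↗ (1 ∷ []) α) α↗
  (↭-trans (kron-↭ (1 ∷ []) α) (↭-reflexive (⊗-identityˡ α)))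

IsZm-1 : IsZm (1 ∷ [])
IsZm-1 = [-] , ≤-refl ∷ [] , ≤-refl

R-dil : ∀ {A C α α₁} → All (1 ≤_) α → All (1 ≤_) α₁ → A ≋ dil α₁ C → R A α ≋ R C (α ⊗ α₁)
R-dil {α = α} p q A≋ = R-cong A≋ α ⟨≋⟩ ≋-sym (R-⊗ _ p q)

-- Primitive solutions and the first construction

module _ {A B : Multiset} {α β : List ℕ} (eA : Exact (R A α)) (α≢1 : α ≢ 1 ∷ []) where

  -- A first construction is a decomposition with γ = δ = (1) and C = D, so primitivity would force
  -- α = α₂ = (1).
  primitive⇒¬first : Primitive A α B β → ¬ FirstConstruction A α B β
  primitive⇒¬first prim (α₁ , α₂ , β₁ , β₂ , C ,
      Zα₁@(_ , p₁ , _) , Zα₂@(_ , p₂ , _) , Zβ₁ , Zβ₂ , C₀ , eq , _ , A≋ , refl , B≋ , refl) =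
    α≢1 (proj₁ (proj₂ (proj₂ (prim α₁ α₂ β₁ β₂ (1 ∷ []) (1 ∷ []) C C Zα₁ Zα₂ Zβ₁ Zβ₂ IsZm-1 IsZm-1 C₀ C₀ card card
      A≋ (sym (kron-identityˡ Zα₂)) B≋ (sym (kron-identityˡ Zβ₂)) eq))))
    where
    card : CardAtLeast2 C
    card = CardAtLeast2-R (⊗-positive p₂ p₁) (λ n → trans (sym (R-dil {A} {C} p₂ p₁ A≋ n)) (eA n))

-- Multiplicative dependence

Dependent : ℕ → ℕ → Set
Dependent l z = ∃₂ λ i j → 0 < j × z ^ j ≡ l ^ i

-- From z^j = l^i and z^j′ = l′^i′ follows l^(i j′) = l′^(i′ j). Independence gives i j′ = 0, hence
-- i = 0 and z^j = 1.
independent⇒≡1 : ∀ {l l′ z} → LogIndep l l′ → Dependent l z → Dependent l′ z → z ≡ 1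
independent⇒≡1 {l} {l′} {z} ind (i , j , 0<j , e) (i′ , j′ , 0<j′ , e′)
  with m*n≡0⇒m≡0∨n≡0 i (proj₁ (ind (i * j′) (i′ * j) same))
  where
  open ≡-Reasoning
  same : l ^ (i * j′) ≡ l′ ^ (i′ * j)
  same = begin
    l ^ (i * j′)     ≡⟨ ^-*-assoc l i j′ ⟨
    (l ^ i) ^ j′     ≡⟨ cong (_^ j′) e ⟨
    (z ^ j) ^ j′     ≡⟨ ^-*-assoc z j j′ ⟩
    z ^ (j * j′)     ≡⟨ cong (z ^_) (*-comm j j′) ⟩
    z ^ (j′ * j)     ≡⟨ ^-*-assoc z j′ j ⟨
    (z ^ j′) ^ j     ≡⟨ cong (_^ j) e′ ⟩
    (l′ ^ i′) ^ j    ≡⟨ ^-*-assoc l′ i′ j ⟩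
    l′ ^ (i′ * j)    ∎
... | inj₂ j′≡0 = contradiction j′≡0 (>⇒≢ 0<j′)
... | inj₁ refl with m^n≡1⇒n≡0∨m≡1 z j e
...   | inj₁ j≡0 = contradiction j≡0 (>⇒≢ 0<j)
...   | inj₂ z≡1 = z≡1

module Refinement {A C : Multiset} {α α₁ α₂ γ : List ℕ} (p₁ : All (1 ≤_) α₁) (p₂ : All (1 ≤_) α₂) (q : All (1 ≤_) γ)
  (eA : Exact (R A α)) (A≋ : A ≋ dil α₁ C) (α≡ : α ≡ kron γ α₂) where

  private
    μ : List ℕ
    μ = (γ ⊗ α₂) ⊗ α₁

    μ-positive : All (1 ≤_) μ
    μ-positive = ⊗-positive (⊗-positive q p₂) p₁

    α↭ : α ↭ γ ⊗ α₂
    α↭ = ↭-trans (↭-reflexive α≡) (kron-↭ γ α₂)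

    -- Both αA and (γα₂α₁)C are the same multiset, so C with the longer vector again represents
    -- every number once.
    exact : Exact (R C μ)
    exact n = trans (sym (R-dil {A} {C} (⊗-positive q p₂) p₁ A≋ n))
      (trans (sym (R-↭ A (All-resp-↭ (↭-sym α↭) (⊗-positive q p₂)) α↭ n)) (eA n))

    ones-product : ones γ * ones α₂ * ones α₁ ≡ 1
    ones-product = trans (cong (_* ones α₁) (sym (ones-⊗ q p₂)))
      (trans (sym (ones-⊗ (⊗-positive q p₂) p₁)) (exact-ones μ-positive exact))

    ones-γα₂ : ones γ * ones α₂ ≡ 1
    ones-γα₂ = m*n≡1⇒m≡1 (ones γ * ones α₂) (ones α₁) ones-product

  ones-α₁ : ones α₁ ≡ 1
  ones-α₁ = m*n≡1⇒n≡1 (ones γ * ones α₂) (ones α₁) ones-product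

  ones-α₂ : ones α₂ ≡ 1
  ones-α₂ = m*n≡1⇒n≡1 (ones γ) (ones α₂) ones-γα₂

  -- Each factor contains a 1, so every entry of one factor reappears in the product. Having exactly
  -- one entry 1, each factor is then (1).
  α₁α₂≡1⇒ : (∀ {z} → z ∈ α₁ ⊗ α₂ → z ≡ 1) → (α₁ ≡ 1 ∷ []) × (α₂ ≡ 1 ∷ [])
  α₁α₂≡1⇒ all =
    all-ones ones-α₁ (λ x∈ → m*n≡1⇒m≡1 _ 1 (all (∈-⊗⁺ x∈ (ones≡1⇒1∈ p₂ ones-α₂)))) ,
    all-ones ones-α₂ (λ y∈ → m*n≡1⇒n≡1 1 _ (all (∈-⊗⁺ (ones≡1⇒1∈ p₁ ones-α₁) y∈)))

  -- Since γ and α₁ contain 1, both z and some entry w ≥ 2 of α occur in `μ`. By `exact⇒powers` they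
  -- are powers of one g, and w is also a power of l.
  dependent : ∀ {l} → (∀ {x} → x ∈ α → ∃ λ i → x ≡ l ^ i) → α ≢ 1 ∷ [] →
    ∀ {z} → z ∈ α₁ ⊗ α₂ → Dependent l z
  dependent {l} powers α≢1 {z} z∈
    with x , y , x∈ , y∈ , refl ← ∈-⊗⁻ α₁ α₂ z∈
    with w , w∈ , 2≤w ← nontrivial-element (All-resp-↭ (↭-sym α↭) (⊗-positive q p₂)) eA α≢1
    with g , base ← exact⇒powers {C} μ-positive exact
    with s , z≡ ← base (∈-⊗⁺ (∈-⊗⁺ (ones≡1⇒1∈ q (m*n≡1⇒m≡1 (ones γ) (ones α₂) ones-γα₂)) y∈) x∈)
       | t , w≡ ← base (∈-⊗⁺ (∈-resp-↭ α↭ w∈) (ones≡1⇒1∈ p₁ ones-α₁))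
    with k , w≡l^k ← powers w∈
    -- With z = g^s and w = g^t = l^k one has z^t = w^s = l^(k s). Here t > 0 because w ≥ 2.
    = k * s , t , n≢0⇒n>0 (λ { refl → contradiction (trans (sym (*-identityʳ w)) w≡) (>⇒≢ 2≤w) }) , (begin
      (x * y) ^ t        ≡⟨ cong (_^ t) (trans (*-comm x y) (trans (cong (_* x) (sym (*-identityˡ y))) z≡)) ⟩
      (g ^ s) ^ t        ≡⟨ ^-*-assoc g s t ⟩
      g ^ (s * t)        ≡⟨ cong (g ^_) (*-comm s t) ⟩
      g ^ (t * s)        ≡⟨ ^-*-assoc g t s ⟨
      (g ^ t) ^ s        ≡⟨ cong (_^ s) (trans (sym w≡) (trans (*-identityʳ w) w≡l^k)) ⟩
      (l ^ k) ^ s        ≡⟨ ^-*-assoc l k s ⟩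
      l ^ (k * s)        ∎)
    where open ≡-Reasoning

-- An entry of the common product α₁α₂ = β₁β₂ depends on both l and l′, hence is 1.
independent⇒primitive : ∀ {l l′ A α B β} → Exact (R A α) → Exact (R B β) → α ≢ 1 ∷ [] → β ≢ 1 ∷ [] →
  (∀ {x} → x ∈ α → ∃ λ i → x ≡ l ^ i) → (∀ {x} → x ∈ β → ∃ λ i → x ≡ l′ ^ i) →
  LogIndep l l′ → Primitive A α B β
independent⇒primitive {l} {l′} {A} {α} {B} {β} eA eB α≢1 β≢1 powers powers′ ind α₁ α₂ β₁ β₂ γ δ C D
  (_ , p₁ , _) (_ , p₂ , _) (_ , q₁ , _) (_ , q₂ , _) (_ , p , _) (_ , q , _) C₀ D₀ _ _ A≋ α≡ B≋ β≡ eq =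
  proj₁ left , proj₁ right , proj₂ left , proj₂ right
  where
  module Left  = Refinement {A} {C} {α} {α₁} {α₂} {γ} p₁ p₂ p eA A≋ α≡
  module Right = Refinement {B} {D} {β} {β₁} {β₂} {δ} q₁ q₂ q eB B≋ β≡
  same : α₁ ⊗ α₂ ↭ β₁ ⊗ β₂
  same = ↭-trans (↭-sym (kron-↭ α₁ α₂)) (↭-trans (↭-reflexive eq) (kron-↭ β₁ β₂))
  all≡1 : ∀ {z} → z ∈ α₁ ⊗ α₂ → z ≡ 1
  all≡1 z∈ = independent⇒≡1 {l} {l′} ind (Left.dependent {l} powers α≢1 z∈)
    (Right.dependent {l′} powers′ β≢1 (∈-resp-↭ same z∈))
  left : (α₁ ≡ 1 ∷ []) × (α₂ ≡ 1 ∷ [])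
  left = Left.α₁α₂≡1⇒ all≡1
  right : (β₁ ≡ 1 ∷ []) × (β₂ ≡ 1 ∷ [])
  right = Right.α₁α₂≡1⇒ (all≡1 ∘ ∈-resp-↭ (↭-sym same))

prodUV-positive : ∀ {r} {u v : Vec ℕ r} → Vec.All (2 ≤_) u → Vec.All (2 ≤_) v → 1 ≤ prodUV u v
prodUV-positive Vec.[] Vec.[] = ≤-refl
prodUV-positive (a Vec.∷ p) (b Vec.∷ q) = *-mono-≤ (*-mono-≤ (<⇒≤ a) (<⇒≤ b)) (prodUV-positive p q)

-- The factor α₁ in λ^(u) S^(λ,N) = α₁ S^(g,L), where λ = g^a and L = a N K

module Refine (g a : ℕ) .{{_ : NonZero g}} {r} (u v : Vec ℕ r) (K : ℕ) where

  private
    l N : ℕ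
    l = g ^ a
    N = prodUV u v
    instance
      l≢0 : NonZero l
      l≢0 = m^n≢0 g a
    G H : List ℕ
    G = geom g 1 a
    H = geom g (a * N) K

  α₁ : List ℕ
  α₁ = kron (lamU l u v) (kron G H)

  positive : All (1 ≤_) α₁
  positive = kron-positive (lamU-positive l 1 u v) (kron-positive (geom-positive g 1 a) (geom-positive g (a * N) K))

  -- U V gives the exponents that are multiples of a below a N, `G` fills the gaps between them, and
  -- `H` appends K copies of the resulting interval.
  α₁⊗α : α₁ ⊗ lamV l u v ↭ geom g 1 (a * N * K)
  α₁⊗α = begin
    kron U (kron G H) ⊗ V      ↭⟨ ⊗-cong (↭-trans (kron-↭ U (kron G H)) (⊗-congʳ U (kron-↭ G H))) (↭-refl {x = V}) ⟩
    (U ⊗ (G ⊗ H)) ⊗ V          ↭⟨ xy∙z≈xz∙y U (G ⊗ H) V ⟩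
    (U ⊗ V) ⊗ (G ⊗ H)          ↭⟨ ⊗-cong (lamU⊗lamV 1 l u v) (↭-refl {x = G ⊗ H}) ⟩
    geom l 1 N ⊗ (G ⊗ H)       ≡⟨ cong (_⊗ (G ⊗ H)) (trans (geom-^ g a 1 N) (cong (λ e → geom g e N) (*-comm a 1))) ⟩
    geom g (1 * a) N ⊗ (G ⊗ H) ≡⟨ ⊗-assoc (geom g (1 * a) N) G H ⟨
    (geom g (1 * a) N ⊗ G) ⊗ H ≡⟨ cong (_⊗ H) (trans (geom-⊗ g 1 a N) (cong (geom g 1) (*-comm N a))) ⟩
    geom g 1 (a * N) ⊗ H       ≡⟨ cong (λ e → geom g 1 (a * N) ⊗ geom g e K) (*-identityˡ (a * N)) ⟨
    geom g 1 (a * N) ⊗ geom g (1 * (a * N)) K ↭⟨ geom-⊗′ g 1 (a * N) K ⟩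
    geom g 1 (a * N * K)       ∎
    where
    open Perm.PermutationReasoning
    U = lamU l u v
    V = lamV l u v

  module _ {C A : Multiset} (exact : Exact (R C (geom g 1 (a * N * K)))) (eA : Exact (R A (lamV l u v))) where

    private
      exact₁ : Exact (R C (α₁ ⊗ lamV l u v))
      exact₁ n = trans (R-↭ C (⊗-positive positive (lamV-positive l 1 u v)) α₁⊗α n) (exact n)

    isZm₁ : IsZm α₁
    isZm₁ = kron-↗ (lamU l u v) (kron G H) , positive , nonempty α₁ exact₁
      where
      nonempty : ∀ α {β} → Exact (R C (α ⊗ β)) → 1 ≤ length α
      nonempty []      e = contradiction (e 1) λ ()
      nonempty (_ ∷ _) e = s≤s z≤n

    isZm : IsZm (lamV l u v)
    isZm = lamV-↗ 1 l u v , lamV-positive l 1 u v , exact-nonempty {A} {lamV l u v} eA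

    -- Both A and α₁C solve the equation R X α = 1 in the unknown X, whose solution is unique.
    refines : A ≋ dil α₁ C
    refines = dil-injective (lamV-positive l 1 u v) eA (λ n →
      trans (sym (R-⊗ C (lamV-positive l 1 u v) positive n))
        (trans (R-↭ C (⊗-positive (lamV-positive l 1 u v) positive) (⊗-comm (lamV l u v) α₁) n) (exact₁ n)))

base≥2 : ∀ g a → 2 ≤ g ^ a → 2 ≤ g × 1 ≤ a
base≥2 g             zero    (s≤s ())
base≥2 zero          (suc a) ()
base≥2 1             (suc a) p = contradiction (subst (2 ≤_) (^-zeroˡ (suc a)) p) λ { (s≤s ()) }
base≥2 (suc (suc g)) (suc a) _ = s≤s (s≤s z≤n) , s≤s z≤n

-- Taking K = b N′ on the left and K = a N on the right makes both Kronecker products equal to (1,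
-- g, ..., g^(L-1)) with the same L, so one digit set serves A and B.
first-construction : ∀ g a b {r r′} {u v : Vec ℕ r} {u′ v′ : Vec ℕ r′} {A B} → 2 ≤ g → 1 ≤ a → 1 ≤ b →
  1 ≤ prodUV u v → 1 ≤ prodUV u′ v′ →
  Exact (R A (lamV (g ^ a) u v)) → Exact (R B (lamV (g ^ b) u′ v′)) →
  NonTrivial A (lamV (g ^ a) u v) B (lamV (g ^ b) u′ v′) →
  FirstConstruction A (lamV (g ^ a) u v) B (lamV (g ^ b) u′ v′)
first-construction g a b {u = u} {v} {u′} {v′} {A} {B} 2≤g 1≤a 1≤b 1≤N 1≤N′ eA eB nontriv =
  Left.α₁ , lamV (g ^ a) u v , Right.α₁ , lamV (g ^ b) u′ v′ , C ,
  Left.isZm₁ {C} {A} exact eA , Left.isZm {C} {A} exact eA ,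
  Right.isZm₁ {C} {B} exact′ eB , Right.isZm {C} {B} exact′ eB , C₀ ,
  kron-≡ Left.α₁ (lamV (g ^ a) u v) Right.α₁ (lamV (g ^ b) u′ v′) (↭-trans Left.α₁⊗α
    (↭-trans (↭-reflexive (cong (geom g 1) (*-comm (a * N) (b * N′)))) (↭-sym Right.α₁⊗α))) ,
  -- Equal pairs would make A and B the same dilate of C and also give α = β.
  (λ eq → nontriv (A≋B (cong proj₁ eq) , cong proj₂ eq)) ,
  A≋ , refl , B≋ , refl
  where
  instance
    g≢0 : NonZero g
    g≢0 = >-nonZero (<⇒≤ 2≤g)
  N N′ : ℕ
  N = prodUV u v
  N′ = prodUV u′ v′
  open DigitSet g (a * N * (b * N′)) 2≤g (*-mono-≤ (*-mono-≤ 1≤a 1≤N) (*-mono-≤ 1≤b 1≤N′))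
  module Left  = Refine g a u v (b * N′)
  module Right = Refine g b u′ v′ (a * N)
  exact′ : Exact (R C (geom g 1 (b * N′ * (a * N))))
  exact′ = subst (λ L → Exact (R C (geom g 1 L))) (*-comm (a * N) (b * N′)) exact
  A≋ : A ≋ dil Left.α₁ C
  A≋ = Left.refines {C} {A} exact eA
  B≋ : B ≋ dil Right.α₁ C
  B≋ = Right.refines {C} {B} exact′ eB
  A≋B : Left.α₁ ≡ Right.α₁ → A ≋ B
  A≋B eq = A≋ ⟨≋⟩ (λ n → cong (λ α → dil α C n) eq) ⟨≋⟩ ≋-sym B≋

-- The equivalence

module _ {l l′ : ℕ} (2≤l : 2 ≤ l) (2≤l′ : 2 ≤ l′) where

  -- If only one exponent is 0, the other power is 1 with positive exponent, which a base of at
  -- least 2 excludes.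
  logIndep : (∀ {p q} → 0 < p → 0 < q → l ^ p ≢ l′ ^ q) → LogIndep l l′
  logIndep ne zero    zero    e = refl , refl
  logIndep ne zero    (suc q) e = contradiction (m^n≡1⇒n≡0∨m≡1 l′ (suc q) (sym e)) [ (λ ()) , >⇒≢ 2≤l′ ]′
  logIndep ne (suc p) zero    e = contradiction (m^n≡1⇒n≡0∨m≡1 l (suc p) e) [ (λ ()) , >⇒≢ 2≤l ]′
  logIndep ne (suc p) (suc q) e = contradiction e (ne {suc p} {suc q} z<s z<s)

theorem1p14 : (l l' : ℕ) → 2 ≤ l → 2 ≤ l' →
    {r r' : ℕ} (u v : Vec ℕ r) (u' v' : Vec ℕ r') →
    Vec.All (2 ≤_) u → Vec.All (2 ≤_) v → Vec.All (2 ≤_) u' → Vec.All (2 ≤_) v' →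
    let A = dil (lamU l u v) (S l (prodUV u v))
        α = lamV l u v
        B = dil (lamU l' u' v') (S l' (prodUV u' v'))
        β = lamV l' u' v'
    in (∀ n → R A α n ≡ 1) → (∀ n → R B β n ≡ 1) →
       NonTrivial A α B β → α ≢ 1 ∷ [] → β ≢ 1 ∷ [] →
       (LogIndep l l' ⇔ Primitive A α B β)
       × (Primitive A α B β ⇔ (FirstConstruction A α B β → ⊥))
theorem1p14 l l' 2≤l 2≤l' u v u' v' 2≤u 2≤v 2≤u' 2≤v' eA eB nontriv α≢1 β≢1 =
  -- The cycle (i) ⇒ (ii) ⇒ (iii) ⇒ (i) yields both equivalences.
  mk⇔ i⇒ii (iii⇒i ∘ ii⇒iii) , mk⇔ ii⇒iii (i⇒ii ∘ iii⇒i)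
  where
  A = dil (lamU l u v) (S l (prodUV u v))
  α = lamV l u v
  B = dil (lamU l' u' v') (S l' (prodUV u' v'))
  β = lamV l' u' v'

  i⇒ii : LogIndep l l' → Primitive A α B β
  i⇒ii = independent⇒primitive {l} {l'} {A} {α} {B} {β} eA eB α≢1 β≢1 (lamV-powers 1 l u v) (lamV-powers 1 l' u' v')

  ii⇒iii : Primitive A α B β → FirstConstruction A α B β → ⊥
  ii⇒iii = primitive⇒¬first {A} {B} {α} {β} eA α≢1

  -- The multisets are variables here, since only their exactness and non-triviality enter once l
  -- and l' are replaced by powers of g.
  first : ∀ {X Y} → CommonBase l l' → Exact (R X α) → Exact (R Y β) → NonTrivial X α Y β → FirstConstruction X α Y β
  first {X} {Y} (g , a , b , l≡ , l'≡) eX eY with refl ← l≡ | refl ← l'≡ =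
    first-construction g a b {u = u} {v} {u'} {v'} {A = X} {B = Y}
      (proj₁ (base≥2 g a 2≤l)) (proj₂ (base≥2 g a 2≤l)) (proj₂ (base≥2 g b 2≤l'))
      (prodUV-positive 2≤u 2≤v) (prodUV-positive 2≤u' 2≤v') eX eY

  iii⇒i : (FirstConstruction A α B β → ⊥) → LogIndep l l'
  iii⇒i ¬first = logIndep 2≤l 2≤l' λ 0<p 0<q e →
    ¬first (first {A} {B} (common-base (l + l') ≤-refl 2≤l 2≤l' 0<p 0<q e) eA eB nontriv)
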